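{- For every fixed integer $r\ge 4$, the limit $\lim_{n\to\infty}\frac{f_r(n,3r-4,3)}{n^2}$ exists and $$\lim_{n\to\infty}\frac{f_r(n,3r-4,3)}{n^2}=\frac{1}{r^2-r-1}.$$
   Context: An $r$-uniform hypergraph ($r$-graph) on a vertex set $V$ is a family of distinct $r$-element subsets of $V$, called edges. For integers $r\ge 2$, $e\ge 2$, $v\ge r+1$, an $r$-graph is called $\mathscr{G}_r(v,e)$-free if the union of any $e$ distinct edges of it contains at least $v+1$ vertices. $f_r(n,v,e)$ denotes the maximum number of edges in a $\mathscr{G}_r(v,e)$-free $r$-graph on $n$ vertices. -}

module Defs where

open import Data.Bool.Properties using () renaming (_≟_ to _≟ᵇ_)
open import Data.Fin using (zero; suc)
open import Data.Fin.Properties using (injective⇒≤)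
open import Data.Fin.Subset using (Subset; inside; outside; ∣_∣; ⋃)
import Data.Integer as ℤ
open import Data.List using (List; []; _∷_; _++_; map; length; lookup)
open import Data.List.Membership.Propositional using (_∈_; find; lose)
open import Data.List.Membership.Propositional.Properties
  using (∈-map⁺; ∈-++⁺ˡ; ∈-++⁺ʳ; ∈-lookup)
open import Data.List.Membership.Setoid.Properties using (index-injective)
open import Data.List.Relation.Binary.Subset.Propositional using (_⊆_)
open import Data.List.Relation.Unary.All as All using (All; []; _∷_)
open import Data.List.Relation.Unary.AllPairs using ([]; _∷_)
open import Data.List.Relation.Unary.Any using (Any; any?; here; there; index)
open import Data.List.Relation.Unary.Unique.DecPropositional using (unique?)
open import Data.List.Relation.Unary.Unique.Propositional using (Unique)
open import Data.Nat
  using (ℕ; zero; suc; _+_; _*_; _∸_; _^_; _≤_; NonZero; z≤n; s≤s; _≟_; _≤?_; >-nonZero)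
open import Data.Nat.Properties
  using (m^n≢0; m<1+n⇒m≤n; ≤∧≢⇒<; suc-injective; ≤-trans; m+n∸m≡n; ∸-monoˡ-≤;
         *-monoˡ-≤; +-identityʳ; *-identityʳ; module ≤-Reasoning)
open import Data.Product using (∃-syntax; _×_; _,_; proj₁; proj₂)
open import Data.Rational as ℚ using (ℚ; 0ℚ)
open import Data.Vec as Vec using ([]; _∷_)
open import Data.Vec.Properties using (≡-dec)
open import Function using (_∘_)
open import Relation.Binary.PropositionalEquality
  using (_≡_; refl; sym; cong; setoid)
open import Relation.Nullary using (Dec; yes; no; contradiction)
open import Relation.Nullary.Decidable using (map′; ¬?; _×-dec_; decidable-stable)
open import Relation.Unary using (Decidable)

-- The order in which the edges are listed is immaterial to every notion below.
record UniformHypergraph (r n : ℕ) : Set where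
  field
    edges   : List (Subset n)
    unique  : Unique edges
    uniform : All (λ A → ∣ A ∣ ≡ r) edges

open UniformHypergraph public

size : ∀ {r n} → UniformHypergraph r n → ℕ
size H = length (edges H)

Free : ∀ {r n} (v e : ℕ) → UniformHypergraph r n → Set
Free v e H = ∀ F → Unique F → F ⊆ edges H → length F ≡ e → v + 1 ≤ ∣ ⋃ F ∣

record IsMaxSize (r n v e m : ℕ) : Set where
  field
    attained   : ∃[ H ] (Free {r} {n} v e H × size H ≡ m)
    upperBound : ∀ (H : UniformHypergraph r n) → Free v e H → size H ≤ m

private
  module _ {A : Set} where

    anyList? : ∀ (xs : List A) k {P : List A → Set} → Decidable P →
               Dec (∃[ F ] (F ⊆ xs × length F ≡ k × P F))
    anyList? xs zero P? =
      map′ (λ p → [] , (λ ()) , refl , p) (λ { ([] , _ , _ , p) → p }) (P? [])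
    anyList? xs (suc k) {P} P? =
      map′ to from (any? (λ x → anyList? xs k (P? ∘ (x ∷_))) xs)
      where
      Q : A → Set
      Q x = ∃[ F ] (F ⊆ xs × length F ≡ k × P (x ∷ F))
      to : Any Q xs → ∃[ F ] (F ⊆ xs × length F ≡ suc k × P F)
      to a with x , x∈ , F , F⊆ , eq , p ← find a =
        x ∷ F , (λ { (here refl) → x∈ ; (there y∈) → F⊆ y∈ }) , cong suc eq , p
      from : ∃[ F ] (F ⊆ xs × length F ≡ suc k × P F) → Any Q xs
      from (x ∷ F , F⊆ , eq , p) =
        lose (F⊆ (here refl)) (F , F⊆ ∘ there , suc-injective eq , p)

    lookup-injective : ∀ {F : List A} → Unique F →
                       ∀ {i j} → lookup F i ≡ lookup F j → i ≡ j
    lookup-injective (_ ∷ _) {zero}  {zero}  _  = refl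
    lookup-injective (x∉ ∷ _) {zero}  {suc j} eq =
      contradiction eq (All.lookup x∉ (∈-lookup j))
    lookup-injective (x∉ ∷ _) {suc i} {zero}  eq =
      contradiction (sym eq) (All.lookup x∉ (∈-lookup i))
    lookup-injective (_ ∷ u) {suc i} {suc j} eq = cong suc (lookup-injective u eq)

    unique⊆⇒length≤ : ∀ {F xs : List A} → Unique F → F ⊆ xs → length F ≤ length xs
    unique⊆⇒length≤ u F⊆ = injective⇒≤ {f = λ i → index (F⊆ (∈-lookup i))}
      (λ eq → lookup-injective u
        (index-injective (setoid A) (F⊆ (∈-lookup _)) (F⊆ (∈-lookup _)) eq))

  allSubsets : ∀ n → List (Subset n)
  allSubsets zero    = [] ∷ []
  allSubsets (suc n) = map (inside ∷_) (allSubsets n) ++ map (outside ∷_) (allSubsets n)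

  ∈-allSubsets : ∀ {n} (A : Subset n) → A ∈ allSubsets n
  ∈-allSubsets []            = here refl
  ∈-allSubsets (inside ∷ A)  = ∈-++⁺ˡ (∈-map⁺ (inside ∷_) (∈-allSubsets A))
  ∈-allSubsets (outside ∷ A) =
    ∈-++⁺ʳ (map (inside ∷_) (allSubsets _)) (∈-map⁺ (outside ∷_) (∈-allSubsets A))

  ⊆-allSubsets : ∀ {n} {E : List (Subset n)} → E ⊆ allSubsets n
  ⊆-allSubsets _ = ∈-allSubsets _

  FreeEdges : ∀ {n} (v e : ℕ) → List (Subset n) → Set
  FreeEdges v e E = ∀ F → Unique F → F ⊆ E → length F ≡ e → v + 1 ≤ ∣ ⋃ F ∣

  freeEdges? : ∀ {n} v e → Decidable (FreeEdges {n} v e)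
  freeEdges? v e E
    with anyList? E e (λ F → unique? (≡-dec _≟ᵇ_) F ×-dec ¬? (v + 1 ≤? ∣ ⋃ F ∣))
  ... | yes (F , F⊆ , eq , u , bad) = no (λ free → bad (free F u F⊆ eq))
  ... | no none = yes (λ F u F⊆ eq →
    decidable-stable (_ ≤? _) (λ bad → none (F , F⊆ , eq , u , bad)))

  Attained : (r n v e m : ℕ) → Set
  Attained r n v e m = ∃[ H ] (Free {r} {n} v e H × size H ≡ m)

  attained? : ∀ r n v e → Decidable (Attained r n v e)
  attained? r n v e m = map′ to from (anyList? (allSubsets n) m good?)
    where
    Good : List (Subset n) → Set
    Good E = Unique E × All (λ A → ∣ A ∣ ≡ r) E × FreeEdges v e E
    good? : Decidable Good
    good? E = unique? (≡-dec _≟ᵇ_) E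
      ×-dec All.all? (λ A → ∣ A ∣ ≟ r) E
      ×-dec freeEdges? v e E
    Found : Set
    Found = ∃[ E ] (E ⊆ allSubsets n × length E ≡ m × Good E)
    to : Found → Attained r n v e m
    to (E , _ , eq , u , a , free) =
      record { edges = E ; unique = u ; uniform = a } , free , eq
    from : Attained r n v e m → Found
    from (H , free , eq) =
      edges H , ⊆-allSubsets , eq , unique H , uniform H , free

  greatest : ∀ {P : ℕ → Set} → Decidable P → P 0 →
             ∀ b → (∀ m → P m → m ≤ b) → ∃[ m ] (P m × (∀ k → P k → k ≤ m))
  greatest P? p₀ zero    bound = 0 , p₀ , bound
  greatest P? p₀ (suc b) bound with P? (suc b)
  ... | yes p = suc b , p , bound
  ... | no ¬p = greatest P? p₀ b (λ m p →
    m<1+n⇒m≤n (≤∧≢⇒< (bound m p) (λ { refl → ¬p p })))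

  empty-attained : ∀ r n v e → .{{NonZero e}} → Attained r n v e 0
  empty-attained r n v (suc e) =
    record { edges = [] ; unique = [] ; uniform = [] }
    , (λ { (A ∷ F) _ F⊆ _ → contradiction (F⊆ (here refl)) (λ ()) })
    , refl

-- For e = 0 no hypergraph is free, as the empty union has fewer than v + 1 vertices.
maxSize-exists : ∀ r n v e → .{{NonZero e}} → ∃[ m ] IsMaxSize r n v e m
maxSize-exists r n v e
  with m , p , ub ← greatest (attained? r n v e) (empty-attained r n v e)
                      (length (allSubsets n))
                      (λ { _ (H , _ , refl) →
                           unique⊆⇒length≤ (unique H) ⊆-allSubsets })
  = m , record { attained = p ; upperBound = λ H free → ub (size H) (H , free , refl) }

f : (r n v e : ℕ) → .{{NonZero e}} → ℕ
f r n v e = proj₁ (maxSize-exists r n v e)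

f-isMaxSize : ∀ r n v e → .{{_ : NonZero e}} → IsMaxSize r n v e (f r n v e)
f-isMaxSize r n v e = proj₂ (maxSize-exists r n v e)

-- Sequences are indexed by the positive integers. The limit is rational, so
-- rational ε suffice.
ConvergesTo : ((n : ℕ) → .{{NonZero n}} → ℚ) → ℚ → Set
ConvergesTo a L =
  ∀ (ε : ℚ) → 0ℚ ℚ.< ε →
  ∃[ N ] (∀ n → .{{_ : NonZero n}} → N ≤ n → ℚ.∣ a n ℚ.- L ∣ ℚ.< ε)

density : (r v e : ℕ) → .{{NonZero e}} → (n : ℕ) → .{{NonZero n}} → ℚ
density r v e n = (ℤ.+ f r n v e) ℚ./ (n ^ 2)
  where instance _ = m^n≢0 n 2

r²-r-1≢0 : ∀ {r} → 4 ≤ r → NonZero (r ^ 2 ∸ r ∸ 1)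
r²-r-1≢0 {r} 4≤r = >-nonZero (begin-strict
  0                  <⟨ s≤s z≤n ⟩
  3                  ≤⟨ ∸-monoˡ-≤ 1 4≤r ⟩
  r ∸ 1              ≡⟨ cong (_∸ 1) (sym (m+n∸m≡n r r)) ⟩
  (r + r) ∸ r ∸ 1    ≤⟨ ∸-monoˡ-≤ 1 (∸-monoˡ-≤ r r+r≤r²) ⟩
  r ^ 2 ∸ r ∸ 1      ∎)
  where
  open ≤-Reasoning
  r+r≤r² : r + r ≤ r ^ 2
  r+r≤r² = begin
    r + r        ≡⟨ cong (r +_) (sym (+-identityʳ r)) ⟩
    2 * r        ≤⟨ *-monoˡ-≤ r (≤-trans (s≤s (s≤s z≤n)) 4≤r) ⟩
    r * r        ≡⟨ cong (r *_) (sym (*-identityʳ r)) ⟩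
    r ^ 2        ∎

{-# OPTIONS --safe #-}

-- Upper bound: an edge that shares at least two vertices with some other edge shares them with only
-- one, and all but O(n) edges share at most two. Counting ordered pairs of vertices by the number
-- of edges containing them then gives (r² − r − 1) e ≤ n² + O(n).
--
-- Lower bound: almost all pairs of vertices have to be covered by edge-disjoint "twins", two r-sets
-- sharing two vertices, such that an edge of one twin meets the vertex set of another twin in at
-- most one vertex. Take s parts. The templates v ↦ β + αv (mod s), each with t multiplicities τ,
-- place the 2r − 2 roles of a twin into the parts so that every pair of parts is covered N − 1
-- times, where N = 1 + 2(r² − r − 1)t. A part consists of the points of ℤ_N^(1 + s²), and a template
-- is realised by all lines through a point b in a direction a, on which a role in part h moves with
-- speed h, except that in the coordinate of a pair of parts i < j both move with speed i and their
-- distance is a colour in ℤ_N, which tells the template and the two roles that cover the pair. The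
-- colour 0 is reserved for pairs of roles in no common edge. So two vertices of one twin that lie
-- in an edge of another determine the template; the direction is read off the other coordinates
-- and, at i < j, off an extra coordinate that moves with the total Σ a. For fixed s and N → ∞ this
-- leaves out a fraction 1/s of the pairs.
module Submission where

open import Defs
open import Data.Bool using (Bool; true; false; _∧_)
open import Data.Fin as Fin
  using (Fin; zero; suc; toℕ; combine; remQuot; punchIn; punchOut; funToFin; finToFun; splitAt;
         _↑ˡ_; _↑ʳ_; inject≤)
import Data.Fin.Properties as Finₚ
open import Data.Fin.Subset
  using (Subset; inside; outside; ∣_∣; ⁅_⁆; ⊥; _∈_; _∪_; _∩_; _⊆_)
open import Data.Fin.Subset.Properties
open import Data.Integer as ℤ using (ℤ) renaming (+_ to pos)
import Data.Integer.Divisibility.Signed as ℤ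
import Data.Integer.Properties as ℤₚ
open import Data.Integer.Tactic.RingSolver using () renaming (solve-∀ to ℤ-solve-∀)
open import Data.List as List using (List; []; _∷_; tabulate)
open import Data.List.Membership.Propositional.Properties using (∈-lookup; ∈-tabulate⁻)
open import Data.List.Properties using (length-tabulate)
open import Data.List.Relation.Unary.All as All using ([]; _∷_)
import Data.List.Relation.Unary.All.Properties as Allₚ
open import Data.List.Relation.Unary.AllPairs using ([]; _∷_)
open import Data.List.Relation.Unary.Any using (here; there)
open import Data.List.Relation.Unary.Unique.Propositional using (Unique)
import Data.List.Relation.Unary.Unique.Propositional.Properties as Uniqueₚ
open import Data.Nat as ℕ hiding (_/_)
open import Data.Nat.Coprimality using (Coprime; coprime-divisor)
open import Data.Nat.DivMod using (_mod_; m%n<n; m≡m%n+[m/n]*n)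
open import Data.Nat.Divisibility
  using (∣⇒≤; ∣1⇒≡1; ∣m+n∣m⇒∣n; ∣n⇒∣m*n; ∣-trans; m∣m*n; m≤n⇒m!∣n!) renaming (_∣_ to _∣ℕ_)
open import Data.Nat.Properties
open import Data.Nat.Tactic.RingSolver using (solve-∀)
open import Algebra.Properties.Semiring.Sum +-*-semiring
  using (sum; sum-remove; sum-cong-≗; ∑-distrib-+; ∑-comm; *-distribˡ-sum; *-distribʳ-sum)
open import Data.Product as Product using (∃-syntax; _×_; _,_; proj₁; proj₂; uncurry)
open import Data.Product.Properties using () renaming (≡-dec to ×-≡-dec)
open import Data.Rational as ℚ using (ℚ; 0ℚ; mkℚ)
import Data.Rational.Properties as ℚₚ
open import Data.Rational.Unnormalised as ℚᵘ using (mkℚᵘ)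
import Data.Rational.Unnormalised.Properties as ℚᵘₚ
open import Data.Sum as Sum using (_⊎_; inj₁; inj₂; [_,_]′)
open import Data.Vec as Vec using ([]; _∷_; here; there)
open import Data.Vec.Functional using (removeAt)
open import Data.Vec.Properties using (lookup-zipWith)
open import Function using (_∘_)
open import Relation.Binary.Definitions using (tri<; tri≈; tri>)
open import Relation.Binary.PropositionalEquality hiding ([_])
open import Relation.Nullary using (¬_; Dec; does; yes; no; contradiction)
open import Relation.Nullary.Decidable using (_×-dec_; ¬?; decidable-stable)

-- Cardinalities of subsets

∣∪∣+∣∩∣ : ∀ {n} (p q : Subset n) → ∣ p ∪ q ∣ + ∣ p ∩ q ∣ ≡ ∣ p ∣ + ∣ q ∣
∣∪∣+∣∩∣ []            []            = refl
∣∪∣+∣∩∣ (inside ∷ p)  (inside ∷ q)  = cong suc (begin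
  ∣ p ∪ q ∣ + suc ∣ p ∩ q ∣   ≡⟨ +-suc _ _ ⟩
  suc (∣ p ∪ q ∣ + ∣ p ∩ q ∣) ≡⟨ cong suc (∣∪∣+∣∩∣ p q) ⟩
  suc (∣ p ∣ + ∣ q ∣)         ≡⟨ +-suc _ _ ⟨
  ∣ p ∣ + suc ∣ q ∣           ∎)
  where open ≡-Reasoning
∣∪∣+∣∩∣ (inside ∷ p)  (outside ∷ q) = cong suc (∣∪∣+∣∩∣ p q)
∣∪∣+∣∩∣ (outside ∷ p) (inside ∷ q)  =
  trans (cong suc (∣∪∣+∣∩∣ p q)) (sym (+-suc _ _))
∣∪∣+∣∩∣ (outside ∷ p) (outside ∷ q) = ∣∪∣+∣∩∣ p q

∣∪∣≤∣p∣+∣q∣ : ∀ {n} (p q : Subset n) → ∣ p ∪ q ∣ ≤ ∣ p ∣ + ∣ q ∣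
∣∪∣≤∣p∣+∣q∣ p q = subst (∣ p ∪ q ∣ ≤_) (∣∪∣+∣∩∣ p q) (m≤m+n _ _)

-- The bracket is what the union of three sets loses. For distinct edges of size r,
-- `Free (3 * r ∸ 4) 3` says that this loss is at most 3; both bounds argue through it.
∣∪∪∣ : ∀ {n} (p q s : Subset n) →
       ∣ (p ∪ q) ∪ s ∣ + (∣ p ∩ q ∣ + ∣ (p ∪ q) ∩ s ∣) ≡ ∣ p ∣ + ∣ q ∣ + ∣ s ∣
∣∪∪∣ p q s = begin
  U + (k + l)             ≡⟨ lemma U k l ⟩
  (U + l) + k             ≡⟨ cong (_+ k) (∣∪∣+∣∩∣ (p ∪ q) s) ⟩
  (∣ p ∪ q ∣ + ∣ s ∣) + k ≡⟨ lemma′ ∣ p ∪ q ∣ ∣ s ∣ k ⟩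
  (∣ p ∪ q ∣ + k) + ∣ s ∣ ≡⟨ cong (_+ ∣ s ∣) (∣∪∣+∣∩∣ p q) ⟩
  ∣ p ∣ + ∣ q ∣ + ∣ s ∣   ∎
  where
  open ≡-Reasoning
  U = ∣ (p ∪ q) ∪ s ∣
  k = ∣ p ∩ q ∣
  l = ∣ (p ∪ q) ∩ s ∣
  lemma : ∀ U k l → U + (k + l) ≡ (U + l) + k
  lemma = solve-∀
  lemma′ : ∀ a b c → (a + b) + c ≡ (a + c) + b
  lemma′ = solve-∀

subsingleton⇒∣p∣≤1 : ∀ {n} (p : Subset n) → (∀ {x y} → x ∈ p → y ∈ p → x ≡ y) → ∣ p ∣ ≤ 1
subsingleton⇒∣p∣≤1 [] _ = z≤n
subsingleton⇒∣p∣≤1 {suc n} (inside ∷ p) sub =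
  s≤s (subst (∣ p ∣ ≤_) (∣⊥∣≡0 n) (p⊆q⇒∣p∣≤∣q∣ {q = ⊥} λ x∈p → contradiction (sub here (there x∈p)) λ ()))
subsingleton⇒∣p∣≤1 (outside ∷ p) sub =
  subsingleton⇒∣p∣≤1 p λ x∈ y∈ → Finₚ.suc-injective (sub (there x∈) (there y∈))

image : ∀ {m n} → (Fin m → Fin n) → Subset n
image {zero}  f = ⊥
image {suc m} f = ⁅ f zero ⁆ ∪ image (f ∘ suc)

∈-image⁺ : ∀ {m n} (f : Fin m → Fin n) i → f i ∈ image f
∈-image⁺ f zero    = x∈p∪q⁺ (inj₁ (x∈⁅x⁆ (f zero)))
∈-image⁺ f (suc i) = x∈p∪q⁺ (inj₂ (∈-image⁺ (f ∘ suc) i))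

∈-image⁻ : ∀ {m n} (f : Fin m → Fin n) {x} → x ∈ image f → ∃[ i ] x ≡ f i
∈-image⁻ {zero}  f x∈ = contradiction x∈ ∉⊥
∈-image⁻ {suc m} f x∈ with x∈p∪q⁻ ⁅ f zero ⁆ (image (f ∘ suc)) x∈
... | inj₁ x∈₁ = zero , x∈⁅y⁆⇒x≡y _ x∈₁
... | inj₂ x∈₂ with i , eq ← ∈-image⁻ (f ∘ suc) x∈₂ = suc i , eq

∣image∣ : ∀ {m n} (f : Fin m → Fin n) → (∀ {i j} → f i ≡ f j → i ≡ j) → ∣ image f ∣ ≡ m
∣image∣ {zero}  {n} f inj = ∣⊥∣≡0 n
∣image∣ {suc m} {n} f inj = begin
  ∣ p ∪ q ∣             ≡⟨ +-identityʳ _ ⟨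
  ∣ p ∪ q ∣ + 0         ≡⟨ cong (∣ p ∪ q ∣ +_) (sym ∣p∩q∣≡0) ⟩
  ∣ p ∪ q ∣ + ∣ p ∩ q ∣ ≡⟨ ∣∪∣+∣∩∣ p q ⟩
  ∣ p ∣ + ∣ q ∣         ≡⟨ cong₂ _+_ (∣⁅x⁆∣≡1 (f zero)) (∣image∣ (f ∘ suc) (Finₚ.suc-injective ∘ inj)) ⟩
  suc m                 ∎
  where
  open ≡-Reasoning
  p = ⁅ f zero ⁆
  q = image (f ∘ suc)
  disjoint : ∀ {x} → ¬ (x ∈ p ∩ q)
  disjoint x∈ with x∈p , x∈q ← x∈p∩q⁻ p q x∈ with i , eq ← ∈-image⁻ (f ∘ suc) x∈q =
    contradiction (inj (trans (sym (x∈⁅y⁆⇒x≡y _ x∈p)) eq)) λ ()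
  ∣p∩q∣≡0 : ∣ p ∩ q ∣ ≡ 0
  ∣p∩q∣≡0 = n≤0⇒n≡0 (subst (∣ p ∩ q ∣ ≤_) (∣⊥∣≡0 n)
    (p⊆q⇒∣p∣≤∣q∣ {q = ⊥} λ x∈ → contradiction x∈ disjoint))

-- Congruences

infix 4 _≡_[mod_]
-- Divisibility is taken in ℤ, where differences exist; the record keeps `x`, `y` and `M` inferable
-- by unification.
record _≡_[mod_] (x y M : ℕ) : Set where
  constructor congruent
  field ∣-difference : pos M ℤ.∣ pos x ℤ.- pos y
open _≡_[mod_]

≡[]-reflexive : ∀ {M x y} → x ≡ y → x ≡ y [mod M ]
≡[]-reflexive {M} {x} refl = congruent (ℤ.divides (pos 0) (ℤₚ.+-inverseʳ (pos x)))

≡[]-trans : ∀ {M x y z} → x ≡ y [mod M ] → y ≡ z [mod M ] → x ≡ z [mod M ]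
≡[]-trans {M} {x} {y} {z} (congruent xy) (congruent yz) =
  congruent (subst (pos M ℤ.∣_) (lemma (pos x) (pos y) (pos z)) (ℤ.∣m∣n⇒∣m+n xy yz))
  where
  lemma : ∀ x y z → (x ℤ.- y) ℤ.+ (y ℤ.- z) ≡ x ℤ.- z
  lemma = ℤ-solve-∀

≡[]-sym : ∀ {M x y} → x ≡ y [mod M ] → y ≡ x [mod M ]
≡[]-sym {M} {x} {y} (congruent xy) =
  congruent (subst (pos M ℤ.∣_) (lemma (pos x) (pos y)) (ℤ.∣m⇒∣-m xy))
  where
  lemma : ∀ x y → ℤ.- (x ℤ.- y) ≡ y ℤ.- x
  lemma = ℤ-solve-∀

%-≡[] : ∀ {M} .{{_ : NonZero M}} x → x ≡ x % M [mod M ]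
%-≡[] {M} x = congruent (ℤ.divides (pos (x ℕ./ M)) (begin
  pos x ℤ.- pos (x % M)                              ≡⟨ cong (λ z → pos z ℤ.- pos (x % M)) (m≡m%n+[m/n]*n x M) ⟩
  pos (x % M + x ℕ./ M * M) ℤ.- pos (x % M)            ≡⟨ cong (ℤ._- pos (x % M)) (ℤₚ.pos-+ (x % M) (x ℕ./ M * M)) ⟩
  (pos (x % M) ℤ.+ pos (x ℕ./ M * M)) ℤ.- pos (x % M)    ≡⟨ lemma (pos (x % M)) (pos (x ℕ./ M * M)) ⟩
  pos (x ℕ./ M * M)                                  ≡⟨ ℤₚ.pos-* (x ℕ./ M) M ⟩
  pos (x ℕ./ M) ℤ.* pos M                              ∎))
  where
  open ≡-Reasoning
  lemma : ∀ x y → (x ℤ.+ y) ℤ.- x ≡ y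
  lemma = ℤ-solve-∀

mod-≡⇒≡[] : ∀ {M} .{{_ : NonZero M}} x y → x mod M ≡ y mod M → x ≡ y [mod M ]
mod-≡⇒≡[] {M} x y eq =
  ≡[]-trans (%-≡[] x) (≡[]-trans (≡[]-reflexive %≡%) (≡[]-sym (%-≡[] y)))
  where
  %≡% : x % M ≡ y % M
  %≡% = trans (sym (Finₚ.toℕ-fromℕ< (m%n<n x M))) (trans (cong toℕ eq) (Finₚ.toℕ-fromℕ< (m%n<n y M)))

+-cancel-≡[] : ∀ {M} x y c d → c ≡ d [mod M ] → x + c ≡ y + d [mod M ] → x ≡ y [mod M ]
+-cancel-≡[] {M} x y c d (congruent cd) (congruent xcyd) = congruent (subst (pos M ℤ.∣_)
  (trans (cong (ℤ._- (pos c ℤ.- pos d)) (cong₂ ℤ._-_ (ℤₚ.pos-+ x c) (ℤₚ.pos-+ y d)))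
    (lemma (pos x) (pos y) (pos c) (pos d)))
  (ℤ.∣m∣n⇒∣m-n xcyd cd))
  where
  lemma : ∀ x y c d → ((x ℤ.+ c) ℤ.- (y ℤ.+ d)) ℤ.- (c ℤ.- d) ≡ x ℤ.- y
  lemma = ℤ-solve-∀

+-cancelʳ-≡[] : ∀ {M} x y c → x + c ≡ y + c [mod M ] → x ≡ y [mod M ]
+-cancelʳ-≡[] x y c = +-cancel-≡[] x y c c (≡[]-reflexive refl)

∣pos-pos∣<M : ∀ {M p q} → p < M → q < M → ℤ.∣ pos p ℤ.- pos q ∣ < M
∣pos-pos∣<M {M} {p} {q} p<M q<M = subst (_< M) (cong ℤ.∣_∣ (sym (ℤₚ.m-n≡m⊖n p q)))
  (≤-<-trans (ℤₚ.∣m⊝n∣≤m⊔n p q) (⊔-lub p<M q<M))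

∣pos-pos∣≡0⇒≡ : ∀ {p q} → ℤ.∣ pos p ℤ.- pos q ∣ ≡ 0 → p ≡ q
∣pos-pos∣≡0⇒≡ {p} {q} = ℤₚ.+-injective ∘ ℤₚ.i-j≡0⇒i≡j (pos p) (pos q) ∘ ℤₚ.∣i∣≡0⇒i≡0

≡[]-<⇒≡ : ∀ {M x y} → x < M → y < M → x ≡ y [mod M ] → x ≡ y
≡[]-<⇒≡ {M} {x} {y} x<M y<M xy = ∣pos-pos∣≡0⇒≡ (∣⇒≡0 (∣pos-pos∣<M x<M y<M) (ℤ.∣⇒∣ᵤ (∣-difference xy)))
  where
  ∣⇒≡0 : ∀ {k} → k < M → M ∣ℕ k → k ≡ 0
  ∣⇒≡0 {zero}  _ _ = refl
  ∣⇒≡0 {suc k} k<M M∣k = contradiction (∣⇒≤ M∣k) (<⇒≱ k<M)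

Fin-≡[]⇒≡ : ∀ {M} {x y : Fin M} → toℕ x ≡ toℕ y [mod M ] → x ≡ y
Fin-≡[]⇒≡ {x = x} {y} = Finₚ.toℕ-injective ∘ ≡[]-<⇒≡ (Finₚ.toℕ<n x) (Finₚ.toℕ<n y)

-- The substitute for a prime modulus: modulo `M`, differences of distinct numbers below `L` can be
-- cancelled.
CoprimeBelow : ℕ → ℕ → Set
CoprimeBelow L M = ∀ k → 0 < k → k < L → Coprime M k

-- A common divisor of `suc (j * L !)` and a positive k < `L` divides `L !`, hence 1. So suitable
-- moduli form an arithmetic progression.
suc-*!-coprimeBelow : ∀ L j → CoprimeBelow L (suc (j * L !))
suc-*!-coprimeBelow L j (suc k) _ k<L {d} (d∣M , d∣k) = ∣1⇒≡1
  (∣m+n∣m⇒∣n (subst (d ∣ℕ_) (+-comm 1 (j * L !)) d∣M)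
    (∣n⇒∣m*n j (∣-trans d∣k (∣-trans (m∣m*n (k !)) (m≤n⇒m!∣n! (<⇒≤ k<L))))))

module _ {L M} (cop : CoprimeBelow L M) where

  ∣z*[p-q]⇒∣z : ∀ z p q → p < L → q < L → p ≢ q → pos M ℤ.∣ z ℤ.* (pos p ℤ.- pos q) → pos M ℤ.∣ z
  ∣z*[p-q]⇒∣z z p q p<L q<L p≢q M∣ = ℤ.∣ᵤ⇒∣ (coprime-divisor
    (cop ℤ.∣ pos p ℤ.- pos q ∣ (n≢0⇒n>0 (p≢q ∘ ∣pos-pos∣≡0⇒≡)) (∣pos-pos∣<M p<L q<L))
    (subst (M ∣ℕ_) (trans (ℤₚ.abs-* z _) (*-comm ℤ.∣ z ∣ _)) (ℤ.∣⇒∣ᵤ M∣)))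

  -- Subtracting the congruences leaves (a - a′)(p - q) ≡ 0, where p - q cancels; the intercepts are
  -- then compared at `p`.
  line-determined : ∀ a b a′ b′ p q → p < L → q < L → p ≢ q →
    b + a * p ≡ b′ + a′ * p [mod M ] → b + a * q ≡ b′ + a′ * q [mod M ] →
    a ≡ a′ [mod M ] × b ≡ b′ [mod M ]
  line-determined a b a′ b′ p q p<L q<L p≢q at-p at-q = aa , bb
    where
    expand : ∀ x → pos (b + a * x) ℤ.- pos (b′ + a′ * x) ≡
                   (pos b ℤ.+ pos a ℤ.* pos x) ℤ.- (pos b′ ℤ.+ pos a′ ℤ.* pos x)
    expand x = cong₂ ℤ._-_
      (trans (ℤₚ.pos-+ b (a * x)) (cong (ℤ._+_ (pos b)) (ℤₚ.pos-* a x)))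
      (trans (ℤₚ.pos-+ b′ (a′ * x)) (cong (ℤ._+_ (pos b′)) (ℤₚ.pos-* a′ x)))
    difference : ∀ a b a′ b′ p q →
      ((b ℤ.+ a ℤ.* p) ℤ.- (b′ ℤ.+ a′ ℤ.* p)) ℤ.- ((b ℤ.+ a ℤ.* q) ℤ.- (b′ ℤ.+ a′ ℤ.* q))
      ≡ (a ℤ.- a′) ℤ.* (p ℤ.- q)
    difference = ℤ-solve-∀
    intercept : ∀ a b a′ b′ p →
      ((b ℤ.+ a ℤ.* p) ℤ.- (b′ ℤ.+ a′ ℤ.* p)) ℤ.- (a ℤ.- a′) ℤ.* p ≡ b ℤ.- b′
    intercept = ℤ-solve-∀
    aa : a ≡ a′ [mod M ]
    aa = congruent (∣z*[p-q]⇒∣z (pos a ℤ.- pos a′) p q p<L q<L p≢q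
      (subst (pos M ℤ.∣_)
        (trans (cong₂ ℤ._-_ (expand p) (expand q)) (difference (pos a) (pos b) (pos a′) (pos b′) (pos p) (pos q)))
        (ℤ.∣m∣n⇒∣m-n (∣-difference at-p) (∣-difference at-q))))
    bb : b ≡ b′ [mod M ]
    bb = congruent (subst (pos M ℤ.∣_)
      (trans (cong (ℤ._- (pos a ℤ.- pos a′) ℤ.* pos p) (expand p)) (intercept (pos a) (pos b) (pos a′) (pos b′) (pos p)))
      (ℤ.∣m∣n⇒∣m-n (∣-difference at-p) (ℤ.∣m⇒∣m*n (pos p) (∣-difference aa))))

sum-determines-entry : ∀ {n M} (a a′ : Fin n → Fin M) i → (∀ j → j ≢ i → a j ≡ a′ j) →
  sum (toℕ ∘ a) ≡ sum (toℕ ∘ a′) [mod M ] → a i ≡ a′ i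
sum-determines-entry {suc n} {M} a a′ i agree sums = Fin-≡[]⇒≡
  (+-cancelʳ-≡[] (toℕ (a i)) (toℕ (a′ i)) (rest a)
    (subst₂ (λ x y → x ≡ y [mod M ])
      (sum-remove {i = i} (toℕ ∘ a))
      (trans (sum-remove {i = i} (toℕ ∘ a′))
        (cong (toℕ (a′ i) +_) (sum-cong-≗ λ j → cong toℕ (sym (agree _ (Finₚ.punchInᵢ≢i i j))))))
      sums))
  where
  rest : (Fin (suc n) → Fin M) → ℕ
  rest a = sum (removeAt (toℕ ∘ a) i)

-- Lines along templates: two common points determine the copy

module Design (R ℓ s₋ t s N : ℕ) .{{_ : NonZero s}} .{{_ : NonZero N}}
              (s₋<s : s₋ < s) (ℓt<N : ℓ * t < N)
              (cop-s : CoprimeBelow R s) (cop-N : CoprimeBelow s N)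
              (g : Fin ℓ → Fin R × Fin R)
  where

  -- One coordinate for every ordered pair (i, j) of parts. Only those with i < j carry a colour; in
  -- the others every part moves with its own speed.
  K = s * s
  Template = Fin (s₋ * (s * t))

  -- The slope α is `suc (toℕ (slope T))` and runs through 1, ..., `s₋`; the value 0, which would
  -- put all roles into one part, does not occur.
  slope : Template → Fin s₋
  slope T = proj₁ (remQuot {s₋} (s * t) T)

  offset : Template → Fin s
  offset T = proj₁ (remQuot {s} t (proj₂ (remQuot {s₋} (s * t) T)))

  copy : Template → Fin t
  copy T = proj₂ (remQuot {s} t (proj₂ (remQuot {s₋} (s * t) T)))

  template-injective : ∀ {T T′} → slope T ≡ slope T′ → offset T ≡ offset T′ → copy T ≡ copy T′ → T ≡ T′
  template-injective {T} {T′} p q r = begin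
    T                                            ≡⟨ assemble T ⟨
    combine (slope T) (combine (offset T) (copy T))    ≡⟨ cong₂ combine p (cong₂ combine q r) ⟩
    combine (slope T′) (combine (offset T′) (copy T′)) ≡⟨ assemble T′ ⟩
    T′                                           ∎
    where
    open ≡-Reasoning
    assemble : ∀ T → combine (slope T) (combine (offset T) (copy T)) ≡ T
    assemble T = trans (cong (combine (slope T)) (Finₚ.combine-remQuot {s} t (proj₂ (remQuot {s₋} (s * t) T))))
      (Finₚ.combine-remQuot {s₋} (s * t) T)

  slope<s : ∀ T → suc (toℕ (slope T)) < s
  slope<s T = ≤-<-trans (Finₚ.toℕ<n (slope T)) s₋<s

  part : Template → Fin R → Fin s
  part T v = (toℕ (offset T) + suc (toℕ (slope T)) * toℕ v) mod s

  -- If distinct roles shared a part, the template would agree at both of them with a constant line;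
  -- so α ≡ 0 modulo `s`, against 0 < α < `s`.
  part-injective : ∀ T {v w} → part T v ≡ part T w → v ≡ w
  part-injective T {v} {w} eq with v Fin.≟ w
  ... | yes v≡w = v≡w
  ... | no  v≢w = contradiction (≡[]-<⇒≡ (slope<s T) (>-nonZero⁻¹ s) slope≡0) λ ()
    where
    at : Fin R → ℕ
    at v = toℕ (offset T) + suc (toℕ (slope T)) * toℕ v
    at-w : at w ≡ at v + 0 * toℕ w [mod s ]
    at-w = ≡[]-trans {x = at w} {at v} {at v + 0 * toℕ w}
      (mod-≡⇒≡[] (at w) (at v) (sym eq)) (≡[]-reflexive (sym (+-identityʳ _)))
    slope≡0 : suc (toℕ (slope T)) ≡ 0 [mod s ]
    slope≡0 = proj₁ (line-determined cop-s (suc (toℕ (slope T))) (toℕ (offset T)) 0 (at v)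
      (toℕ v) (toℕ w) (Finₚ.toℕ<n v) (Finₚ.toℕ<n w) (v≢w ∘ Finₚ.toℕ-injective)
      (≡[]-reflexive (sym (+-identityʳ _))) at-w)

  -- α and β are the coefficients of a line known at two places. The multiplicity is invisible to
  -- the parts and has to be supplied.
  template-determined : ∀ {T T′ v w} → v ≢ w → copy T ≡ copy T′ →
    part T v ≡ part T′ v → part T w ≡ part T′ w → T ≡ T′
  template-determined {T} {T′} {v} {w} v≢w same-copy at-v at-w = template-injective
    (Finₚ.toℕ-injective (suc-injective
      (≡[]-<⇒≡ (slope<s T) (slope<s T′) (proj₁ both))))
    (Fin-≡[]⇒≡ (proj₂ both))
    same-copy
    where
    both = line-determined cop-s (suc (toℕ (slope T))) (toℕ (offset T))
      (suc (toℕ (slope T′))) (toℕ (offset T′))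
      (toℕ v) (toℕ w) (Finₚ.toℕ<n v) (Finₚ.toℕ<n w) (v≢w ∘ Finₚ.toℕ-injective)
      (mod-≡⇒≡[] _ _ at-v) (mod-≡⇒≡[] _ _ at-w)

  g⁻¹? : ∀ v w → Dec (∃[ x ] g x ≡ (v , w))
  g⁻¹? v w = Finₚ.any? λ x → ×-≡-dec Fin._≟_ Fin._≟_ (g x) (v , w)

  colour : Template → Fin R → Fin R → ℕ
  colour T v w with g⁻¹? v w
  ... | yes (x , _) = suc (toℕ (combine x (copy T)))
  ... | no  _       = 0

  colour<N : ∀ T v w → colour T v w < N
  colour<N T v w with g⁻¹? v w
  ... | yes (x , _) = ≤-<-trans (Finₚ.toℕ<n (combine x (copy T))) ℓt<N
  ... | no  _       = >-nonZero⁻¹ N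

  -- Only the primed pair is assumed adjacent: its colour is then positive, so the other pair cannot
  -- have the reserved colour 0 either.
  colour-injective : ∀ {T T′ v w v′ w′} → ∃[ x ] g x ≡ (v′ , w′) → colour T v w ≡ colour T′ v′ w′ →
    v ≡ v′ × w ≡ w′ × copy T ≡ copy T′
  colour-injective {T} {T′} {v} {w} {v′} {w′} edge eq with g⁻¹? v w | g⁻¹? v′ w′
  ... | _ | no ¬edge = contradiction edge ¬edge
  ... | yes (x , gx) | yes (x′ , gx′)
    with refl , copies ← Finₚ.combine-injective x (copy T) x′ (copy T′)
           (Finₚ.toℕ-injective (suc-injective eq))
    with refl ← trans (sym gx) gx′ = refl , refl , copies

  -- Indexed by the part of the first role, since a coordinate knows parts and not roles; 0 if the
  -- template has no role in part `i`.
  colourFrom : Template → Fin s → Fin R → ℕ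
  colourFrom T i w with Finₚ.any? (λ v → part T v Fin.≟ i)
  ... | yes (v , _) = colour T v w
  ... | no  _       = 0

  colourFrom-part : ∀ T v w → colourFrom T (part T v) w ≡ colour T v w
  colourFrom-part T v w with Finₚ.any? (λ u → part T u Fin.≟ part T v)
  ... | yes (u , eq) = cong (λ u → colour T u w) (part-injective T eq)
  ... | no  ¬∃       = contradiction (v , refl) ¬∃

  -- In the coordinate of a pair of parts i < j, part j is given the multiplier of part i, so
  -- that there the difference of two vertices in these parts is only the colour of their roles.
  Merged : Fin s → Fin s × Fin s → Set
  Merged h (i , j) = i Fin.< j × h ≡ j

  merged? : ∀ h e → Dec (Merged h e)
  merged? h (i , j) = (i Fin.<? j) ×-dec (h Fin.≟ j)

  multiplier : Fin s → Fin s × Fin s → Fin s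
  multiplier h e with merged? h e
  ... | yes _ = proj₁ e
  ... | no  _ = h

  shift : Template → Fin R → Fin s × Fin s → ℕ
  shift T v e with merged? (part T v) e
  ... | yes _ = colourFrom T (proj₁ e) v
  ... | no  _ = 0

  multiplier-merged : ∀ {h e} → Merged h e → multiplier h e ≡ proj₁ e
  multiplier-merged {h} {e} m with merged? h e
  ... | yes _ = refl
  ... | no ¬m = contradiction m ¬m

  multiplier-unmerged : ∀ {h e} → ¬ Merged h e → multiplier h e ≡ h
  multiplier-unmerged {h} {e} ¬m with merged? h e
  ... | yes m = contradiction m ¬m
  ... | no  _ = refl

  shift-merged : ∀ {T v e} → Merged (part T v) e → shift T v e ≡ colourFrom T (proj₁ e) v
  shift-merged {T} {v} {e} m with merged? (part T v) e
  ... | yes _ = refl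
  ... | no ¬m = contradiction m ¬m

  shift-unmerged : ∀ {T v e} → ¬ Merged (part T v) e → shift T v e ≡ 0
  shift-unmerged {T} {v} {e} ¬m with merged? (part T v) e
  ... | yes m = contradiction m ¬m
  ... | no  _ = refl

  -- Merging replaces a part by a smaller one. So i < j receive the same speed only if j is merged
  -- into i, which happens in the coordinate (i, j) alone.
  multipliers-differ : ∀ {i j e} → i Fin.< j → e ≢ (i , j) → multiplier i e ≢ multiplier j e
  multipliers-differ {i} {j} {i′ , j′} i<j e≢ with merged? i (i′ , j′) | merged? j (i′ , j′)
  ... | yes (i<i , refl) | yes (_ , refl) = contradiction i<j (Finₚ.<-irrefl refl)
  ... | yes (i′<i , refl) | no _ = λ { refl → Finₚ.<-asym i<j i′<i }
  ... | no _ | yes (_ , refl) = λ { refl → e≢ refl }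
  ... | no _ | no _ = λ { refl → Finₚ.<-irrefl refl i<j }

  heightAt : Template → (Fin K → Fin N) → (Fin (suc K) → Fin N) → Fin R → Fin K → Fin s × Fin s → ℕ
  heightAt T a b v e ij =
    toℕ (b (suc e)) + toℕ (a e) * toℕ (multiplier (part T v) ij) + shift T v ij

  height : Template → (Fin K → Fin N) → (Fin (suc K) → Fin N) → Fin R → Fin (suc K) → ℕ
  height T a b v zero    = toℕ (b zero) + sum (toℕ ∘ a) * toℕ (part T v)
  height T a b v (suc e) = heightAt T a b v e (remQuot s e)

  coord : Template → (Fin K → Fin N) → (Fin (suc K) → Fin N) → Fin R → Fin (suc K) → Fin N
  coord T a b v e = height T a b v e mod N

  height-lower : ∀ T a b v j → part T v Fin.< j → let e = combine (part T v) j in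
    height T a b v (suc e) ≡ toℕ (b (suc e)) + toℕ (a e) * toℕ (part T v)
  height-lower T a b v j v<j = begin
    heightAt T a b v e (remQuot s e)             ≡⟨ cong (heightAt T a b v e) (Finₚ.remQuot-combine (part T v) j) ⟩
    heightAt T a b v e (part T v , j)            ≡⟨ cong₂ (λ h c → toℕ (b (suc e)) + toℕ (a e) * toℕ h + c)
                                                      (multiplier-unmerged ¬merged) (shift-unmerged {T} {v} ¬merged) ⟩
    toℕ (b (suc e)) + toℕ (a e) * toℕ (part T v) + 0 ≡⟨ +-identityʳ _ ⟩
    toℕ (b (suc e)) + toℕ (a e) * toℕ (part T v) ∎
    where
    open ≡-Reasoning
    e = combine (part T v) j
    ¬merged : ¬ Merged (part T v) (part T v , j)
    ¬merged (_ , eq) = Finₚ.<-irrefl eq v<j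

  height-upper : ∀ T a b v w → part T v Fin.< part T w → let e = combine (part T v) (part T w) in
    height T a b w (suc e) ≡ toℕ (b (suc e)) + toℕ (a e) * toℕ (part T v) + colour T v w
  height-upper T a b v w v<w = begin
    heightAt T a b w e (remQuot s e)          ≡⟨ cong (heightAt T a b w e) (Finₚ.remQuot-combine (part T v) (part T w)) ⟩
    heightAt T a b w e (part T v , part T w)  ≡⟨ cong₂ (λ h c → toℕ (b (suc e)) + toℕ (a e) * toℕ h + c)
                                                   (multiplier-merged merged)
                                                   (trans (shift-merged {T} {w} merged) (colourFrom-part T v w)) ⟩
    toℕ (b (suc e)) + toℕ (a e) * toℕ (part T v) + colour T v w ∎
    where
    open ≡-Reasoning
    e = combine (part T v) (part T w)
    merged : Merged (part T w) (part T v , part T w)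
    merged = v<w , refl

  Meet : Template → (Fin K → Fin N) → (Fin (suc K) → Fin N) → Fin R →
    Template → (Fin K → Fin N) → (Fin (suc K) → Fin N) → Fin R → Set
  Meet T a b v T′ a′ b′ v′ = part T v ≡ part T′ v′ × (∀ e → coord T a b v e ≡ coord T′ a′ b′ v′ e)

  meet-height : ∀ {T a b v T′ a′ b′ v′} → Meet T a b v T′ a′ b′ v′ →
    ∀ e → height T a b v e ≡ height T′ a′ b′ v′ e [mod N ]
  meet-height {T} {a} {b} {v} {T′} {a′} {b′} {v′} (_ , eq) e =
    mod-≡⇒≡[] (height T a b v e) (height T′ a′ b′ v′ e) (eq e)

  -- In the coordinate of the two parts both vertices move with the speed of the lower part and only
  -- the upper one is shifted, so their difference is the colour. Colours lie below `N`, hence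
  -- congruent ones are equal.
  meet-colour : ∀ {T a b v w T′ a′ b′ v′ w′} → part T v Fin.< part T w →
    Meet T a b v T′ a′ b′ v′ → Meet T a b w T′ a′ b′ w′ → colour T v w ≡ colour T′ v′ w′
  meet-colour {T} {a} {b} {v} {w} {T′} {a′} {b′} {v′} {w′} v<w mv@(pv , _) mw@(pw , _) =
    ≡[]-<⇒≡ (colour<N T v w) (colour<N T′ v′ w′)
      (+-cancel-≡[] (colour T v w) (colour T′ v′ w′) (base T a b v w) (base T′ a′ b′ v′ w′) lower
        (subst₂ (λ x y → x ≡ y [mod N ]) (+-comm (base T a b v w) _) (+-comm (base T′ a′ b′ v′ w′) _) upper))
    where
    base : ∀ T → (Fin K → Fin N) → (Fin (suc K) → Fin N) → Fin R → Fin R → ℕ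
    base T a b v w = let e = combine (part T v) (part T w) in
      toℕ (b (suc e)) + toℕ (a e) * toℕ (part T v)
    e = combine (part T v) (part T w)
    e≡ : e ≡ combine (part T′ v′) (part T′ w′)
    e≡ = cong₂ combine pv pw
    v′<w′ : part T′ v′ Fin.< part T′ w′
    v′<w′ = subst₂ Fin._<_ pv pw v<w
    lower : base T a b v w ≡ base T′ a′ b′ v′ w′ [mod N ]
    lower = subst₂ (λ x y → x ≡ y [mod N ])
      (height-lower T a b v (part T w) v<w)
      (trans (cong (height T′ a′ b′ v′ ∘ suc) e≡) (height-lower T′ a′ b′ v′ (part T′ w′) v′<w′))
      (meet-height {T} {a} {b} {v} {T′} {a′} {b′} {v′} mv (suc e))
    upper : base T a b v w + colour T v w ≡ base T′ a′ b′ v′ w′ + colour T′ v′ w′ [mod N ]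
    upper = subst₂ (λ x y → x ≡ y [mod N ])
      (height-upper T a b v w v<w)
      (trans (cong (height T′ a′ b′ w′ ∘ suc) e≡) (height-upper T′ a′ b′ v′ w′ v′<w′))
      (meet-height {T} {a} {b} {w} {T′} {a′} {b′} {w′} mw (suc e))

  -- The shifts depend on template and role only, so they cancel between two lines of one template.
  -- The speeds differ, and the line is known at two places.
  meet-elsewhere : ∀ {T a b a′ b′ v w} → part T v Fin.< part T w →
    Meet T a b v T a′ b′ v → Meet T a b w T a′ b′ w →
    ∀ e → remQuot s e ≢ (part T v , part T w) → a e ≡ a′ e × b (suc e) ≡ b′ (suc e)
  meet-elsewhere {T} {a} {b} {a′} {b′} {v} {w} v<w mv mw e e≢ = Product.map Fin-≡[]⇒≡ Fin-≡[]⇒≡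
    (line-determined cop-N (toℕ (a e)) (toℕ (b (suc e))) (toℕ (a′ e)) (toℕ (b′ (suc e)))
      (toℕ (multiplier (part T v) (remQuot s e))) (toℕ (multiplier (part T w) (remQuot s e)))
      (Finₚ.toℕ<n _) (Finₚ.toℕ<n _)
      (multipliers-differ v<w e≢ ∘ Finₚ.toℕ-injective)
      (+-cancelʳ-≡[] _ _ (shift T v (remQuot s e)) (meet-height {T} {a} {b} {v} {T} {a′} {b′} {v} mv (suc e)))
      (+-cancelʳ-≡[] _ _ (shift T w (remQuot s e)) (meet-height {T} {a} {b} {w} {T} {a′} {b′} {w} mw (suc e))))

  -- The extra coordinate is never merged, so there distinct parts always have distinct speeds.
  meet-infinity : ∀ {T a b a′ b′ v w} → part T v ≢ part T w →
    Meet T a b v T a′ b′ v → Meet T a b w T a′ b′ w →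
    sum (toℕ ∘ a) ≡ sum (toℕ ∘ a′) [mod N ] × b zero ≡ b′ zero
  meet-infinity {T} {a} {b} {a′} {b′} {v} {w} i≢j mv mw = Product.map₂ Fin-≡[]⇒≡
    (line-determined cop-N (sum (toℕ ∘ a)) (toℕ (b zero)) (sum (toℕ ∘ a′)) (toℕ (b′ zero))
      (toℕ (part T v)) (toℕ (part T w)) (Finₚ.toℕ<n _) (Finₚ.toℕ<n _) (i≢j ∘ Finₚ.toℕ-injective)
      (meet-height {T} {a} {b} {v} {T} {a′} {b′} {v} mv zero)
      (meet-height {T} {a} {b} {w} {T} {a′} {b′} {w} mw zero))

  meet-origin : ∀ {T a b a′ b′ v} j → part T v Fin.< j → Meet T a b v T a′ b′ v →
    let e = combine (part T v) j in a e ≡ a′ e → b (suc e) ≡ b′ (suc e)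
  meet-origin {T} {a} {b} {a′} {b′} {v} j v<j mv a-e = Fin-≡[]⇒≡
    (+-cancelʳ-≡[] (toℕ (b (suc e))) (toℕ (b′ (suc e))) (toℕ (a e) * toℕ (part T v))
      (subst₂ (λ x y → x ≡ y [mod N ])
        (height-lower T a b v j v<j)
        (trans (height-lower T a′ b′ v j v<j)
          (cong (λ z → toℕ (b′ (suc e)) + toℕ z * toℕ (part T v)) (sym a-e)))
        (meet-height {T} {a} {b} {v} {T} {a′} {b′} {v} mv (suc e))))
    where
    e = combine (part T v) j

  remQuot-injective : ∀ {i j : Fin s} {e : Fin K} → remQuot s e ≡ (i , j) → e ≡ combine i j
  remQuot-injective {e = e} eq = trans (sym (Finₚ.combine-remQuot {s} s e)) (cong (uncurry combine) eq)

  -- The coordinate of the pair of parts says nothing about its own direction, as both vertices have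
  -- the same speed there. The extra coordinate gives Σ a, and all other entries are known.
  meet-directions : ∀ {T a b a′ b′ v w} → part T v Fin.< part T w →
    Meet T a b v T a′ b′ v → Meet T a b w T a′ b′ w → ∀ e → a e ≡ a′ e
  meet-directions {T} {a} {b} {a′} {b′} {v} {w} v<w mv mw e
    with e Fin.≟ combine (part T v) (part T w)
  ... | no  e≢f  = proj₁ (meet-elsewhere {T} {a} {b} {a′} {b′} v<w mv mw e (e≢f ∘ remQuot-injective))
  ... | yes refl = sum-determines-entry a a′ _
    (λ e e≢f → proj₁ (meet-elsewhere {T} {a} {b} {a′} {b′} v<w mv mw e (e≢f ∘ remQuot-injective)))
    (proj₁ (meet-infinity {T} {a} {b} {a′} {b′} (λ eq → Finₚ.<-irrefl eq v<w) mv mw))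

  meet-origins : ∀ {T a b a′ b′ v w} → part T v Fin.< part T w →
    Meet T a b v T a′ b′ v → Meet T a b w T a′ b′ w → ∀ e → b e ≡ b′ e
  meet-origins {T} {a} {b} {a′} {b′} v<w mv mw zero =
    proj₂ (meet-infinity {T} {a} {b} {a′} {b′} (λ eq → Finₚ.<-irrefl eq v<w) mv mw)
  meet-origins {T} {a} {b} {a′} {b′} {v} {w} v<w mv mw (suc e)
    with e Fin.≟ combine (part T v) (part T w)
  ... | no  e≢f  = proj₂ (meet-elsewhere {T} {a} {b} {a′} {b′} v<w mv mw e (e≢f ∘ remQuot-injective))
  -- With the direction known, the lower vertex alone gives the origin in this coordinate.
  ... | yes refl = meet-origin {T} {a} {b} {a′} {b′} (part T w) v<w mv
    (meet-directions {T} {a} {b} {a′} {b′} v<w mv mw _)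

  Agree : Template → (Fin K → Fin N) → (Fin (suc K) → Fin N) →
    Template → (Fin K → Fin N) → (Fin (suc K) → Fin N) → Set
  Agree T a b T′ a′ b′ = T ≡ T′ × (∀ e → a e ≡ a′ e) × (∀ e → b e ≡ b′ e)

  meet-twice-same : ∀ {T a b v w T′ a′ b′ v′ w′} → T ≡ T′ → v ≡ v′ → w ≡ w′ → part T v Fin.< part T w →
    Meet T a b v T′ a′ b′ v′ → Meet T a b w T′ a′ b′ w′ → Agree T a b T′ a′ b′
  meet-twice-same {T} {a} {b} {v} {w} {T} {a′} {b′} refl refl refl v<w mv mw =
    refl , meet-directions {T} {a} {b} {a′} {b′} v<w mv mw , meet-origins {T} {a} {b} {a′} {b′} v<w mv mw

  -- The colour yields both roles and the multiplicity; the parts of these roles then yield the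
  -- template, and only now can the lines be compared.
  meet-twice-< : ∀ {T a b v w T′ a′ b′ v′ w′} → part T v Fin.< part T w → ∃[ x ] g x ≡ (v′ , w′) →
    Meet T a b v T′ a′ b′ v′ → Meet T a b w T′ a′ b′ w′ → Agree T a b T′ a′ b′
  meet-twice-< {T} {a} {b} {v} {w} {T′} {a′} {b′} {v′} {w′} v<w edge mv mw =
    meet-twice-same {T} {a} {b} {v} {w} {T′} {a′} {b′} {v′} {w′} T≡T′ v≡v′ w≡w′ v<w mv mw
    where
    roles : v ≡ v′ × w ≡ w′ × copy T ≡ copy T′
    roles = colour-injective {T} {T′} edge (meet-colour {T} {a} {b} {v} {w} {T′} {a′} {b′} v<w mv mw)
    v≡v′ = proj₁ roles
    w≡w′ = proj₁ (proj₂ roles)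
    T≡T′ : T ≡ T′
    T≡T′ = template-determined {T} {T′} {v} {w} (λ v≡w → Finₚ.<-irrefl (cong (part T) v≡w) v<w)
      (proj₂ (proj₂ roles))
      (trans (proj₁ mv) (cong (part T′) (sym v≡v′))) (trans (proj₁ mw) (cong (part T′) (sym w≡w′)))

  -- Which of the two vertices lies in the lower part is unknown, so adjacency is required in both
  -- orders.
  meet-twice : ∀ {T a b v w T′ a′ b′ v′ w′} → v ≢ w →
    ∃[ x ] g x ≡ (v′ , w′) → ∃[ x ] g x ≡ (w′ , v′) →
    Meet T a b v T′ a′ b′ v′ → Meet T a b w T′ a′ b′ w′ → Agree T a b T′ a′ b′
  meet-twice {T} {a} {b} {v} {w} {T′} {a′} {b′} v≢w vw wv mv mw
    with Finₚ.<-cmp (part T v) (part T w)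
  ... | tri< v<w _ _ = meet-twice-< {T} {a} {b} {v} {w} {T′} {a′} {b′} v<w vw mv mw
  ... | tri≈ _ eq _  = contradiction (part-injective T eq) v≢w
  ... | tri> _ _ w<v = meet-twice-< {T} {a} {b} {w} {v} {T′} {a′} {b′} w<v wv mw mv

-- The packing of twins

funToFin-cong : ∀ {m n} {f g : Fin m → Fin n} → (∀ i → f i ≡ g i) → funToFin f ≡ funToFin g
funToFin-cong {zero}  eq = refl
funToFin-cong {suc m} eq = cong₂ combine (eq zero) (funToFin-cong (eq ∘ suc))

-- The twin: two (2 + d)-sets of roles, indexed by z, which share exactly the roles 0 and 1.
module Twin (d : ℕ) where

  Role = Fin (2 + 2 * d)

  role : Fin 2 → Fin (2 + d) → Role
  role z zero          = zero
  role z (suc zero)    = suc zero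
  role z (suc (suc i)) = suc (suc (combine z i))

  role-injective : ∀ z {k l} → role z k ≡ role z l → k ≡ l
  role-injective z {zero}        {zero}        _  = refl
  role-injective z {suc zero}    {suc zero}    _  = refl
  role-injective z {zero}        {suc zero}    ()
  role-injective z {zero}        {suc (suc _)} ()
  role-injective z {suc zero}    {zero}        ()
  role-injective z {suc zero}    {suc (suc _)} ()
  role-injective z {suc (suc _)} {zero}        ()
  role-injective z {suc (suc _)} {suc zero}    ()
  role-injective z {suc (suc i)} {suc (suc j)} eq =
    cong (λ i → suc (suc i)) (Finₚ.combine-injectiveʳ z i z j (Finₚ.suc-injective (Finₚ.suc-injective eq)))

  role-common : ∀ {z z′ k l} → z ≢ z′ → role z k ≡ role z′ l → role z k ≡ zero ⊎ role z k ≡ suc zero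
  role-common {k = zero}        _    _  = inj₁ refl
  role-common {k = suc zero}    _    _  = inj₂ refl
  role-common {k = suc (suc _)} {zero}     _ ()
  role-common {k = suc (suc _)} {suc zero} _ ()
  role-common {z} {z′} {suc (suc i)} {suc (suc j)} z≢z′ eq = contradiction
    (Finₚ.combine-injectiveˡ z i z′ j (Finₚ.suc-injective (Finₚ.suc-injective eq))) z≢z′

  -- This is 2 (r² − r − 1) for r = 2 + d: the pairs starting in one of the two shared roles, followed
  -- by the pairs starting in one of the 2d others.
  orientedEdges : ℕ
  orientedEdges = 2 * (1 + 2 * d) + 2 * d * (1 + d)

  from-shared : Fin 2 × Fin (1 + 2 * d) → Role × Role
  from-shared (k , j) = k ↑ˡ (2 * d) , punchIn (k ↑ˡ (2 * d)) j

  from-own : Fin (2 * d) × Fin (1 + d) → Role × Role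
  from-own (zi , j) = let z , i = remQuot {2} d zi in role z (suc (suc i)) , role z (punchIn (suc (suc i)) j)

  from : Fin (2 * (1 + 2 * d)) ⊎ Fin (2 * d * (1 + d)) → Role × Role
  from = [ from-shared ∘ remQuot {2} (1 + 2 * d) , from-own ∘ remQuot {2 * d} (1 + d) ]′

  orientedEdge : Fin orientedEdges → Role × Role
  orientedEdge x = from (splitAt (2 * (1 + 2 * d)) x)

  orientedEdge-shared : ∀ k {v} → k ↑ˡ (2 * d) ≢ v → ∃[ x ] orientedEdge x ≡ (k ↑ˡ (2 * d) , v)
  orientedEdge-shared k {v} k≢v = combine k j ↑ˡ (2 * d * (1 + d)) , (begin
    orientedEdge (combine k j ↑ˡ _)                   ≡⟨ cong from (Finₚ.splitAt-↑ˡ _ (combine k j) _) ⟩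
    from-shared (remQuot {2} (1 + 2 * d) (combine k j)) ≡⟨ cong from-shared (Finₚ.remQuot-combine k j) ⟩
    from-shared (k , j)                               ≡⟨ cong (k ↑ˡ (2 * d) ,_) (Finₚ.punchIn-punchOut k≢v) ⟩
    (k ↑ˡ (2 * d) , v)                                ∎)
    where
    open ≡-Reasoning
    j = punchOut k≢v

  orientedEdge-own : ∀ z i {l} → suc (suc i) ≢ l →
    ∃[ x ] orientedEdge x ≡ (role z (suc (suc i)) , role z l)
  orientedEdge-own z i {l} i≢l = 2 * (1 + 2 * d) ↑ʳ combine (combine z i) j , (begin
    orientedEdge (2 * (1 + 2 * d) ↑ʳ combine (combine z i) j)
      ≡⟨ cong from (Finₚ.splitAt-↑ʳ (2 * (1 + 2 * d)) _ (combine (combine z i) j)) ⟩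
    from-own (remQuot {2 * d} (1 + d) (combine (combine z i) j)) ≡⟨ cong from-own (Finₚ.remQuot-combine (combine z i) j) ⟩
    from-own (combine z i , j)
      ≡⟨ cong (λ (z , i) → role z (suc (suc i)) , role z (punchIn (suc (suc i)) j)) (Finₚ.remQuot-combine z i) ⟩
    (role z (suc (suc i)) , role z (punchIn (suc (suc i)) j))
      ≡⟨ cong (λ l → role z (suc (suc i)) , role z l) (Finₚ.punchIn-punchOut i≢l) ⟩
    (role z (suc (suc i)) , role z l) ∎)
    where
    open ≡-Reasoning
    j = punchOut i≢l

  role-adjacent : ∀ z {k l} → k ≢ l → ∃[ x ] orientedEdge x ≡ (role z k , role z l)
  role-adjacent z {zero}        k≢l = orientedEdge-shared zero (k≢l ∘ role-injective z)
  role-adjacent z {suc zero}    k≢l = orientedEdge-shared (suc zero) (k≢l ∘ role-injective z)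
  role-adjacent z {suc (suc i)} k≢l = orientedEdge-own z i k≢l

-- Freeness of a packing of twins

module TwinPacking (d n copies : ℕ) (point : Fin copies → Twin.Role (suc d) → Fin n)
  (point-injective : ∀ {c v w} → point c v ≡ point c w → v ≡ w)
  (determined : ∀ c c′ z′ {v w k l} → v ≢ w →
    point c v ≡ point c′ (Twin.role (suc d) z′ k) → point c w ≡ point c′ (Twin.role (suc d) z′ l) → c ≡ c′)
  where

  open Twin (suc d)

  r = 3 + d

  edge : Fin copies → Fin 2 → Subset n
  edge c z = image (point c ∘ role z)

  ∣edge∣ : ∀ c z → ∣ edge c z ∣ ≡ r
  ∣edge∣ c z = ∣image∣ (point c ∘ role z) (role-injective z ∘ point-injective)

  meets-edge-once : ∀ {c c′ z′ x y v w k l} → c ≢ c′ → x ≡ point c v → y ≡ point c w →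
    x ≡ point c′ (role z′ k) → y ≡ point c′ (role z′ l) → x ≡ y
  meets-edge-once {c} {c′} {z′} {x} {y} c≢c′ xv yw xk yl = decidable-stable (x Fin.≟ y) λ x≢y →
    c≢c′ (determined c c′ z′ (λ v≡w → x≢y (trans xv (trans (cong (point c) v≡w) (sym yw))))
      (trans (sym xv) xk) (trans (sym yw) yl))

  -- `P` is a general set of points of a copy, so that it can be one edge or the union of both edges
  -- of a twin.
  ∣points∩edge∣≤1 : ∀ {c c′ z′} (P : Subset n) → (∀ {x} → x ∈ P → ∃[ v ] x ≡ point c v) → c ≢ c′ →
    ∣ P ∩ edge c′ z′ ∣ ≤ 1
  ∣points∩edge∣≤1 {c} {c′} {z′} P onCopy c≢c′ = subsingleton⇒∣p∣≤1 (P ∩ edge c′ z′) λ x∈ y∈ →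
    let x∈P , x∈E = x∈p∩q⁻ P (edge c′ z′) x∈
        y∈P , y∈E = x∈p∩q⁻ P (edge c′ z′) y∈
    in meets-edge-once {c} {c′} {z′} c≢c′ (proj₂ (onCopy x∈P)) (proj₂ (onCopy y∈P))
         (proj₂ (∈-image⁻ (point c′ ∘ role z′) x∈E)) (proj₂ (∈-image⁻ (point c′ ∘ role z′) y∈E))

  edge-onCopy : ∀ c z {x} → x ∈ edge c z → ∃[ v ] x ≡ point c v
  edge-onCopy c z x∈ with k , eq ← ∈-image⁻ (point c ∘ role z) x∈ = role z k , eq

  edges-onCopy : ∀ c z z′ {x} → x ∈ edge c z ∪ edge c z′ → ∃[ v ] x ≡ point c v
  edges-onCopy c z z′ x∈ = [ edge-onCopy c z , edge-onCopy c z′ ]′ (x∈p∪q⁻ (edge c z) (edge c z′) x∈)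

  ∣twin∩∣≤2 : ∀ c {z z′} → z ≢ z′ → ∣ edge c z ∩ edge c z′ ∣ ≤ 2
  ∣twin∩∣≤2 c {z} {z′} z≢z′ = begin
    ∣ edge c z ∩ edge c z′ ∣ ≤⟨ p⊆q⇒∣p∣≤∣q∣ shared ⟩
    ∣ p ∪ q ∣                ≤⟨ ∣∪∣≤∣p∣+∣q∣ p q ⟩
    ∣ p ∣ + ∣ q ∣            ≡⟨ cong₂ _+_ (∣⁅x⁆∣≡1 (point c zero)) (∣⁅x⁆∣≡1 (point c (suc zero))) ⟩
    2                        ∎
    where
    open ≤-Reasoning
    p = ⁅ point c zero ⁆
    q = ⁅ point c (suc zero) ⁆
    shared : edge c z ∩ edge c z′ ⊆ p ∪ q
    shared x∈ with x∈₁ , x∈₂ ← x∈p∩q⁻ (edge c z) (edge c z′) x∈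
      with k , refl ← ∈-image⁻ (point c ∘ role z) x∈₁ | l , eq ← ∈-image⁻ (point c ∘ role z′) x∈₂
      with role-common {z} {z′} {k} {l} z≢z′ (point-injective eq)
    ... | inj₁ eq₀ = x∈p∪q⁺ (inj₁ (subst (_∈ p) (cong (point c) (sym eq₀)) (x∈⁅x⁆ (point c zero))))
    ... | inj₂ eq₁ = x∈p∪q⁺ (inj₂ (subst (_∈ q) (cong (point c) (sym eq₁)) (x∈⁅x⁆ (point c (suc zero)))))

  -- Equal edges would share r ≥ 3 vertices, but edges of different copies share at most 1 and the
  -- two edges of a twin at most 2.
  edge-injective : ∀ {c c′ z z′} → edge c z ≡ edge c′ z′ → c ≡ c′ × z ≡ z′
  edge-injective {c} {c′} {z} {z′} eq with c Fin.≟ c′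
  ... | no c≢c′ = contradiction
    (subst (_≤ 1) self (∣points∩edge∣≤1 {c} {c′} {z′} (edge c z) (edge-onCopy c z) c≢c′)) λ { (s≤s ()) }
    where
    self : ∣ edge c z ∩ edge c′ z′ ∣ ≡ r
    self = trans (cong (λ e → ∣ edge c z ∩ e ∣) (sym eq)) (trans (cong ∣_∣ (∩-idem (edge c z))) (∣edge∣ c z))
  ... | yes refl with z Fin.≟ z′
  ... | yes z≡z′ = refl , z≡z′
  ... | no  z≢z′ = contradiction (subst (_≤ 2) self (∣twin∩∣≤2 c z≢z′)) λ { (s≤s (s≤s ())) }
    where
    self : ∣ edge c z ∩ edge c z′ ∣ ≡ r
    self = trans (cong (λ e → ∣ edge c z ∩ e ∣) (sym eq)) (trans (cong ∣_∣ (∩-idem (edge c z))) (∣edge∣ c z))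

  -- A union of at least 3r - 3 vertices, without subtraction and bracketed as `⋃` unfolds.
  Spread : Subset n → Subset n → Subset n → Set
  Spread p q s = 3 * r ≤ ∣ p ∪ (q ∪ s) ∣ + 3

  spread-rotate : ∀ {p q s} → Spread p q s → Spread q s p
  spread-rotate {p} {q} {s} = subst (λ u → 3 * r ≤ ∣ u ∣ + 3)
    (trans (∪-comm p (q ∪ s)) (∪-assoc q s p))

  spread : ∀ c₁ c₂ c₃ z₁ z₂ z₃ → let p = edge c₁ z₁; q = edge c₂ z₂; s = edge c₃ z₃ in
    ∣ p ∩ q ∣ + ∣ (p ∪ q) ∩ s ∣ ≤ 3 → Spread p q s
  spread c₁ c₂ c₃ z₁ z₂ z₃ small = begin
    3 * r                           ≡⟨ 3*r r ⟩
    r + r + r                       ≡⟨ cong₂ _+_ (cong₂ _+_ (∣edge∣ c₁ z₁) (∣edge∣ c₂ z₂)) (∣edge∣ c₃ z₃) ⟨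
    ∣ p ∣ + ∣ q ∣ + ∣ u ∣           ≡⟨ ∣∪∪∣ p q u ⟨
    ∣ (p ∪ q) ∪ u ∣ + (∣ p ∩ q ∣ + ∣ (p ∪ q) ∩ u ∣) ≤⟨ +-mono-≤ (≤-reflexive (cong ∣_∣ (∪-assoc p q u))) small ⟩
    ∣ p ∪ (q ∪ u) ∣ + 3             ∎
    where
    open ≤-Reasoning
    p = edge c₁ z₁
    q = edge c₂ z₂
    u = edge c₃ z₃
    3*r : ∀ r → 3 * r ≡ r + r + r
    3*r = solve-∀

  spread-twin : ∀ c c′ z₁ z₂ z′ → z₁ ≢ z₂ → c ≢ c′ → Spread (edge c z₁) (edge c z₂) (edge c′ z′)
  spread-twin c c′ z₁ z₂ z′ z₁≢z₂ c≢c′ = spread c c c′ z₁ z₂ z′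
    (+-mono-≤ (∣twin∩∣≤2 c z₁≢z₂)
      (∣points∩edge∣≤1 {c} {c′} {z′} (edge c z₁ ∪ edge c z₂) (edges-onCopy c z₁ z₂) c≢c′))

  spread-distinct : ∀ c₁ c₂ c₃ z₁ z₂ z₃ → c₁ ≢ c₂ → c₁ ≢ c₃ → c₂ ≢ c₃ →
    Spread (edge c₁ z₁) (edge c₂ z₂) (edge c₃ z₃)
  spread-distinct c₁ c₂ c₃ z₁ z₂ z₃ c₁≢c₂ c₁≢c₃ c₂≢c₃ = spread c₁ c₂ c₃ z₁ z₂ z₃
    (+-mono-≤ (∣points∩edge∣≤1 {c₁} {c₂} {z₂} p (edge-onCopy c₁ z₁) c₁≢c₂) (begin
      ∣ (p ∪ q) ∩ u ∣         ≡⟨ cong ∣_∣ (∩-distribʳ-∪ u p q) ⟩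
      ∣ (p ∩ u) ∪ (q ∩ u) ∣   ≤⟨ ∣∪∣≤∣p∣+∣q∣ (p ∩ u) (q ∩ u) ⟩
      ∣ p ∩ u ∣ + ∣ q ∩ u ∣   ≤⟨ +-mono-≤ (∣points∩edge∣≤1 {c₁} {c₃} {z₃} p (edge-onCopy c₁ z₁) c₁≢c₃)
                                          (∣points∩edge∣≤1 {c₂} {c₃} {z₃} q (edge-onCopy c₂ z₂) c₂≢c₃) ⟩
      2                       ∎))
    where
    open ≤-Reasoning
    p = edge c₁ z₁
    q = edge c₂ z₂
    u = edge c₃ z₃

  no-three : ∀ {z₁ z₂ z₃ : Fin 2} → z₁ ≢ z₂ → z₁ ≢ z₃ → z₂ ≡ z₃
  no-three {zero}     {zero}     z₁≢z₂ _ = contradiction refl z₁≢z₂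
  no-three {zero}     {suc zero} {zero}     _ z₁≢z₃ = contradiction refl z₁≢z₃
  no-three {zero}     {suc zero} {suc zero} _ _ = refl
  no-three {suc zero} {suc zero} z₁≢z₂ _ = contradiction refl z₁≢z₂
  no-three {suc zero} {zero}     {suc zero} _ z₁≢z₃ = contradiction refl z₁≢z₃
  no-three {suc zero} {zero}     {zero}     _ _ = refl

  -- A copy has only two edges. If two of the three form a twin, the loss is at most 2 + 1; if all
  -- copies differ, at most 1 + 1 + 1. Rotations bring the twin to the front.
  edges-spread : ∀ c₁ c₂ c₃ z₁ z₂ z₃ → let p = edge c₁ z₁; q = edge c₂ z₂; s = edge c₃ z₃ in
    p ≢ q → p ≢ s → q ≢ s → Spread p q s
  edges-spread c₁ c₂ c₃ z₁ z₂ z₃ p≢q p≢s q≢s with c₁ Fin.≟ c₂ | c₁ Fin.≟ c₃ | c₂ Fin.≟ c₃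
  ... | yes refl | yes refl | _ = contradiction
    (cong (edge c₁) (no-three {z₁} {z₂} {z₃} (p≢q ∘ cong (edge c₁)) (p≢s ∘ cong (edge c₁)))) q≢s
  ... | yes refl | no c₁≢c₃ | _ = spread-twin c₁ c₃ z₁ z₂ z₃ (p≢q ∘ cong (edge c₁)) c₁≢c₃
  ... | no c₁≢c₂ | yes refl | _ = spread-rotate {edge c₁ z₃} {edge c₁ z₁} (spread-twin c₁ c₂ z₃ z₁ z₂ (p≢s ∘ sym ∘ cong (edge c₁)) c₁≢c₂)
  ... | no c₁≢c₂ | no _ | yes refl = spread-rotate {edge c₂ z₃} {edge c₁ z₁}
    (spread-rotate {edge c₂ z₂} (spread-twin c₂ c₁ z₂ z₃ z₁ (q≢s ∘ cong (edge c₂)) (c₁≢c₂ ∘ sym)))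
  ... | no c₁≢c₂ | no c₁≢c₃ | no c₂≢c₃ = spread-distinct c₁ c₂ c₃ z₁ z₂ z₃ c₁≢c₂ c₁≢c₃ c₂≢c₃

  edgeAt : Fin (copies * 2) → Subset n
  edgeAt x = uncurry edge (remQuot {copies} 2 x)

  edgeAt-injective : ∀ {x y} → edgeAt x ≡ edgeAt y → x ≡ y
  edgeAt-injective {x} {y} eq
    with same-copy , same-side ← edge-injective {z = proj₂ (remQuot {copies} 2 x)}
           {proj₂ (remQuot {copies} 2 y)} eq = begin
    x                                   ≡⟨ Finₚ.combine-remQuot {copies} 2 x ⟨
    uncurry combine (remQuot {copies} 2 x)       ≡⟨ cong₂ combine same-copy same-side ⟩
    uncurry combine (remQuot {copies} 2 y)       ≡⟨ Finₚ.combine-remQuot {copies} 2 y ⟩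
    y                                   ∎
    where open ≡-Reasoning

  hypergraph : UniformHypergraph r n
  hypergraph = record
    { edges   = tabulate edgeAt
    ; unique  = Uniqueₚ.tabulate⁺ edgeAt-injective
    ; uniform = Allₚ.tabulate⁺ λ x → uncurry ∣edge∣ (remQuot {copies} 2 x)
    }

  size-hypergraph : size hypergraph ≡ copies * 2
  size-hypergraph = length-tabulate edgeAt

  hypergraph-free : Free (3 * r ∸ 4) 3 hypergraph
  hypergraph-free (p ∷ q ∷ s ∷ []) ((p≢q ∷ p≢s ∷ []) ∷ (q≢s ∷ []) ∷ [] ∷ []) F⊆ refl
    with x , refl ← ∈-tabulate⁻ {f = edgeAt} (F⊆ (here refl))
       | y , refl ← ∈-tabulate⁻ {f = edgeAt} (F⊆ (there (here refl)))
       | z , refl ← ∈-tabulate⁻ {f = edgeAt} (F⊆ (there (there (here refl))))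
    = subst (λ u → 3 * r ∸ 4 + 1 ≤ ∣ edgeAt x ∪ (edgeAt y ∪ u) ∣) (sym (∪-identityʳ (edgeAt z)))
        (+-cancelʳ-≤ 3 _ _ (begin
          3 * r ∸ 4 + 1 + 3 ≡⟨ +-assoc (3 * r ∸ 4) 1 3 ⟩
          3 * r ∸ 4 + 4     ≡⟨ m∸n+n≡m 4≤3r ⟩
          3 * r             ≤⟨ edges-spread (proj₁ (pair x)) (proj₁ (pair y)) (proj₁ (pair z))
                                 (proj₂ (pair x)) (proj₂ (pair y)) (proj₂ (pair z)) p≢q p≢s q≢s ⟩
          ∣ edgeAt x ∪ (edgeAt y ∪ edgeAt z) ∣ + 3 ∎))
    where
    open ≤-Reasoning
    pair = remQuot {copies} 2
    4≤3r : 4 ≤ 3 * r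
    4≤3r = ≤-trans (s≤s (s≤s (s≤s (s≤s z≤n)))) (*-monoʳ-≤ 3 (m≤m+n 3 d))

-- The packing on n vertices

module Packing (d s₋ t s N n : ℕ) .{{_ : NonZero s}} .{{_ : NonZero N}}
               (s₋<s : s₋ < s) (ℓt<N : Twin.orientedEdges (suc d) * t < N)
               (cop-s : CoprimeBelow (2 + 2 * suc d) s) (cop-N : CoprimeBelow s N)
               (fits : s * N ^ suc (s * s) ≤ n)
  where

  open Twin (suc d)
  open Design (2 + 2 * suc d) orientedEdges s₋ t s N s₋<s ℓt<N cop-s cop-N orientedEdge

  copies : ℕ
  copies = s₋ * (s * t) * (N ^ K * N ^ suc K)

  template : Fin copies → Template
  template c = proj₁ (remQuot {s₋ * (s * t)} (N ^ K * N ^ suc K) c)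

  line : Fin copies → Fin (N ^ K * N ^ suc K)
  line c = proj₂ (remQuot {s₋ * (s * t)} (N ^ K * N ^ suc K) c)

  directions : Fin copies → Fin K → Fin N
  directions c = finToFun (proj₁ (remQuot {N ^ K} (N ^ suc K) (line c)))

  origin : Fin copies → Fin (suc K) → Fin N
  origin c = finToFun (proj₂ (remQuot {N ^ K} (N ^ suc K) (line c)))

  agree⇒≡ : ∀ {c c′} → Agree (template c) (directions c) (origin c) (template c′) (directions c′) (origin c′) → c ≡ c′
  agree⇒≡ {c} {c′} (p , q , q′) = begin
    c            ≡⟨ assemble c ⟨
    combine (template c) (combine (funToFin (directions c)) (funToFin (origin c)))
                 ≡⟨ cong₂ combine p (cong₂ combine (funToFin-cong q) (funToFin-cong q′)) ⟩
    combine (template c′) (combine (funToFin (directions c′)) (funToFin (origin c′)))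
                 ≡⟨ assemble c′ ⟩
    c′           ∎
    where
    open ≡-Reasoning
    assemble : ∀ c → combine (template c) (combine (funToFin (directions c)) (funToFin (origin c))) ≡ c
    assemble c = trans (cong (combine (template c)) (trans
        (cong₂ combine
          (Finₚ.funToFin-finToFin {K} {N} (proj₁ (remQuot {N ^ K} (N ^ suc K) (line c))))
          (Finₚ.funToFin-finToFin {suc K} {N} (proj₂ (remQuot {N ^ K} (N ^ suc K) (line c)))))
        (Finₚ.combine-remQuot {N ^ K} (N ^ suc K) (line c))))
      (Finₚ.combine-remQuot {s₋ * (s * t)} (N ^ K * N ^ suc K) c)

  coordinates : Fin copies → Role → Fin (suc K) → Fin N
  coordinates c = coord (template c) (directions c) (origin c)

  -- The first `s * N ^ suc K` vertices are the points of the parts; the others stay isolated.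
  point : Fin copies → Role → Fin n
  point c v = inject≤ (combine (part (template c) v) (funToFin (coordinates c v))) fits

  point-meet : ∀ {c v c′ v′} → point c v ≡ point c′ v′ →
    Meet (template c) (directions c) (origin c) v (template c′) (directions c′) (origin c′) v′
  point-meet {c} {v} {c′} {v′} eq = proj₁ both , λ e → begin
    coordinates c v e                          ≡⟨ Finₚ.finToFun-funToFin (coordinates c v) e ⟨
    finToFun (funToFin (coordinates c v)) e    ≡⟨ cong (λ k → finToFun k e) (proj₂ both) ⟩
    finToFun (funToFin (coordinates c′ v′)) e  ≡⟨ Finₚ.finToFun-funToFin (coordinates c′ v′) e ⟩
    coordinates c′ v′ e                        ∎
    where
    open ≡-Reasoning
    both = Finₚ.combine-injective (part (template c) v) (funToFin (coordinates c v))
             (part (template c′) v′) (funToFin (coordinates c′ v′)) (Finₚ.inject≤-injective fits fits _ _ eq)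

  point-injective : ∀ {c v w} → point c v ≡ point c w → v ≡ w
  point-injective {c} {v} {w} eq = part-injective (template c) (proj₁ (point-meet {c} {v} {c} {w} eq))

  determined : ∀ c c′ z′ {v w k l} → v ≢ w →
    point c v ≡ point c′ (role z′ k) → point c w ≡ point c′ (role z′ l) → c ≡ c′
  determined c c′ z′ {v} {w} {k} {l} v≢w eqv eqw = agree⇒≡ (meet-twice v≢w
    (role-adjacent z′ k≢l) (role-adjacent z′ (k≢l ∘ sym))
    (point-meet {c} {v} {c′} {role z′ k} eqv) (point-meet {c} {w} {c′} {role z′ l} eqw))
    where
    k≢l : k ≢ l
    k≢l k≡l = v≢w (point-injective (trans eqv (trans (cong (point c′ ∘ role z′) k≡l) (sym eqw))))

  open TwinPacking d n copies point point-injective determined public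
    using (hypergraph; size-hypergraph; hypergraph-free)

-- The upper bound

sum-mono : ∀ {n} {g h : Fin n → ℕ} → (∀ i → g i ≤ h i) → sum g ≤ sum h
sum-mono {zero}  g≤h = z≤n
sum-mono {suc n} g≤h = +-mono-≤ (g≤h zero) (sum-mono (g≤h ∘ suc))

sum-const : ∀ n c → sum {n} (λ _ → c) ≡ n * c
sum-const zero    c = refl
sum-const (suc n) c = cong (c +_) (sum-const n c)

-- The entries at `i` change sides, which avoids subtraction. This serves to leave out diagonal
-- pairs and, with `g` zero, to bound one entry by the sum.
sum-mono-except : ∀ {n} (g h : Fin n → ℕ) i → (∀ j → j ≢ i → g j ≤ h j) → sum g + h i ≤ sum h + g i
sum-mono-except {suc n} g h i g≤h = begin
  sum g + h i                        ≡⟨ cong (_+ h i) (sum-remove {i = i} g) ⟩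
  g i + sum (removeAt g i) + h i     ≤⟨ +-monoˡ-≤ (h i) (+-monoʳ-≤ (g i) (sum-mono λ j → g≤h _ (Finₚ.punchInᵢ≢i i j))) ⟩
  g i + sum (removeAt h i) + h i     ≡⟨ swap (g i) (sum (removeAt h i)) (h i) ⟩
  h i + sum (removeAt h i) + g i     ≡⟨ cong (_+ g i) (sum-remove {i = i} h) ⟨
  sum h + g i                        ∎
  where
  open ≤-Reasoning
  swap : ∀ a b c → a + b + c ≡ c + b + a
  swap = solve-∀

sum-≤-single : ∀ {n} (h : Fin n → ℕ) c → (∀ i → h i ≤ c) →
  (∀ i j → i ≢ j → h i ≡ 0 ⊎ h j ≡ 0) → sum h ≤ c
sum-≤-single {zero}  h c h≤c sparse = z≤n
sum-≤-single {suc n} h c h≤c sparse with h zero ≟ 0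
... | yes h₀≡0 = subst (λ z → z + sum (h ∘ suc) ≤ c) (sym h₀≡0)
  (sum-≤-single (h ∘ suc) c (h≤c ∘ suc) λ i j i≢j → sparse (suc i) (suc j) (i≢j ∘ Finₚ.suc-injective))
... | no h₀≢0 = begin
  h zero + sum (h ∘ suc) ≤⟨ +-monoʳ-≤ (h zero) (sum-≤-single (h ∘ suc) 0 (≤-reflexive ∘ rest≡0)
                              λ i _ _ → inj₁ (rest≡0 i)) ⟩
  h zero + 0             ≡⟨ +-identityʳ _ ⟩
  h zero                 ≤⟨ h≤c zero ⟩
  c                      ∎
  where
  open ≤-Reasoning
  rest≡0 : ∀ i → h (suc i) ≡ 0
  rest≡0 i = [ (λ h₀≡0 → contradiction h₀≡0 h₀≢0) , (λ eq → eq) ]′ (sparse zero (suc i) λ ())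

sum-≤-double : ∀ {n} (h : Fin n → ℕ) c → (∀ i → h i ≤ c) →
  (∀ i j k → i ≢ j → i ≢ k → j ≢ k → h i ≡ 0 ⊎ h j ≡ 0 ⊎ h k ≡ 0) → sum h ≤ 2 * c
sum-≤-double {zero}  h c h≤c sparse = z≤n
sum-≤-double {suc n} h c h≤c sparse with h zero ≟ 0
... | yes h₀≡0 = subst (λ z → z + sum (h ∘ suc) ≤ 2 * c) (sym h₀≡0)
  (sum-≤-double (h ∘ suc) c (h≤c ∘ suc) λ i j k i≢j i≢k j≢k → sparse (suc i) (suc j) (suc k)
    (i≢j ∘ Finₚ.suc-injective) (i≢k ∘ Finₚ.suc-injective) (j≢k ∘ Finₚ.suc-injective))
... | no h₀≢0 = +-mono-≤ (h≤c zero) (subst (sum (h ∘ suc) ≤_) (sym (+-identityʳ c))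
  (sum-≤-single (h ∘ suc) c (h≤c ∘ suc) λ i j i≢j →
    [ (λ h₀≡0 → contradiction h₀≡0 h₀≢0) , (λ eq → eq) ]′
      (sparse zero (suc i) (suc j) (λ ()) (λ ()) (i≢j ∘ Finₚ.suc-injective))))

∑-comm₃ : ∀ {l m n} (h : Fin l → Fin m → Fin n → ℕ) →
  sum (λ x → sum λ y → sum λ i → h x y i) ≡ sum (λ i → sum λ x → sum λ y → h x y i)
∑-comm₃ h = trans (sum-cong-≗ λ x → ∑-comm (h x)) (∑-comm λ x i → sum λ y → h x y i)

-- Codegrees

[_]ᵇ : Bool → ℕ
[ true  ]ᵇ = 1
[ false ]ᵇ = 0

[∧]ᵇ : ∀ a b → [ a ∧ b ]ᵇ ≡ [ a ]ᵇ * [ b ]ᵇ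
[∧]ᵇ true  b = sym (+-identityʳ [ b ]ᵇ)
[∧]ᵇ false b = refl

[]ᵇ-idem : ∀ a → [ a ]ᵇ * [ a ]ᵇ ≡ [ a ]ᵇ
[]ᵇ-idem true  = refl
[]ᵇ-idem false = refl

χ : ∀ {n} → Subset n → Fin n → ℕ
χ p x = [ Vec.lookup p x ]ᵇ

∣∣≡∑χ : ∀ {n} (p : Subset n) → ∣ p ∣ ≡ sum (χ p)
∣∣≡∑χ []          = refl
∣∣≡∑χ (true  ∷ p) = cong suc (∣∣≡∑χ p)
∣∣≡∑χ (false ∷ p) = ∣∣≡∑χ p

χ-∩ : ∀ {n} (p q : Subset n) x → χ (p ∩ q) x ≡ χ p x * χ q x
χ-∩ p q x = trans (cong [_]ᵇ (lookup-zipWith _∧_ x p q)) ([∧]ᵇ (Vec.lookup p x) (Vec.lookup q x))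

codegree : ∀ {m n} → (Fin m → Subset n) → Fin n → Fin n → ℕ
codegree A x y = sum λ i → χ (A i) x * χ (A i) y

∑∑codegree : ∀ {m n} (A : Fin m → Subset n) →
  sum (λ x → sum λ y → codegree A x y) ≡ sum λ i → ∣ A i ∣ * ∣ A i ∣
∑∑codegree A = trans (∑-comm₃ λ x y i → χ (A i) x * χ (A i) y) (sum-cong-≗ λ i → begin
  sum (λ x → sum λ y → χ (A i) x * χ (A i) y) ≡⟨ sum-cong-≗ (λ x → *-distribˡ-sum (χ (A i) x) (χ (A i))) ⟨
  sum (λ x → χ (A i) x * sum (χ (A i)))       ≡⟨ *-distribʳ-sum (sum (χ (A i))) (χ (A i)) ⟨
  sum (χ (A i)) * sum (χ (A i))               ≡⟨ cong₂ _*_ (∣∣≡∑χ (A i)) (∣∣≡∑χ (A i)) ⟨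
  ∣ A i ∣ * ∣ A i ∣                           ∎)
  where open ≡-Reasoning

∑codegree-diagonal : ∀ {m n} (A : Fin m → Subset n) →
  sum (λ x → codegree A x x) ≡ sum λ i → ∣ A i ∣
∑codegree-diagonal A = trans (∑-comm λ x i → χ (A i) x * χ (A i) x)
  (sum-cong-≗ λ i → trans (sum-cong-≗ λ x → []ᵇ-idem (Vec.lookup (A i) x)) (sym (∣∣≡∑χ (A i))))

-- The square counts ordered pairs of edges through `x` and `y`, that is, pairs whose intersection
-- contains both. Summed over all `x`, `y` this gives squared intersection sizes, and over `x = y`
-- the sizes themselves.
codegree-square : ∀ {m n} (A : Fin m → Subset n) x y →
  codegree A x y * codegree A x y ≡ sum λ i → codegree (λ j → A i ∩ A j) x y
codegree-square A x y = begin
  codegree A x y * codegree A x y              ≡⟨ *-distribʳ-sum (codegree A x y) (λ i → χ (A i) x * χ (A i) y) ⟩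
  sum (λ i → χ (A i) x * χ (A i) y * codegree A x y)
    ≡⟨ sum-cong-≗ (λ i → *-distribˡ-sum (χ (A i) x * χ (A i) y) (λ j → χ (A j) x * χ (A j) y)) ⟩
  sum (λ i → sum λ j → χ (A i) x * χ (A i) y * (χ (A j) x * χ (A j) y))
    ≡⟨ sum-cong-≗ (λ i → sum-cong-≗ λ j → trans
         (interchange (χ (A i) x) (χ (A i) y) (χ (A j) x) (χ (A j) y))
         (sym (cong₂ _*_ (χ-∩ (A i) (A j) x) (χ-∩ (A i) (A j) y)))) ⟩
  sum (λ i → codegree (λ j → A i ∩ A j) x y)   ∎
  where
  open ≡-Reasoning
  interchange : ∀ a b c d → a * b * (c * d) ≡ a * c * (b * d)
  interchange = solve-∀

3d≤d²+2 : ∀ d → 3 * d ≤ d * d + 2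
3d≤d²+2 zero = z≤n
3d≤d²+2 (suc zero) = ≤-refl
3d≤d²+2 (suc (suc d)) = subst (3 * (2 + d) ≤_) (lemma d) (m≤m+n _ _)
  where
  lemma : ∀ d → 3 * (2 + d) + (d * d + d) ≡ (2 + d) * (2 + d) + 2
  lemma = solve-∀

-- A pair of points in d edges satisfies 2d − d(d − 1) = 2 − (d − 1)(d − 2) ≤ 2; summed over all
-- ordered pairs, this bounds the number of edges by their pairwise intersections.
pair-count : ∀ {m n} (A : Fin m → Subset n) →
  3 * sum (λ i → ∣ A i ∣ * ∣ A i ∣) + sum (λ i → sum λ j → ∣ A i ∩ A j ∣)
  ≤ sum (λ i → sum λ j → ∣ A i ∩ A j ∣ * ∣ A i ∩ A j ∣) + n * (n * 2) + 3 * sum (λ i → ∣ A i ∣)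
pair-count {m} {n} A = begin
  3 * sum (λ i → ∣ A i ∣ * ∣ A i ∣) + sum (λ i → sum λ j → ∣ A i ∩ A j ∣)
    ≡⟨ cong₂ _+_ (cong (3 *_) (sym (∑∑codegree A))) (sym diagonal²) ⟩
  3 * sum (λ x → sum λ y → D x y) + sum (λ x → D x x * D x x)
    ≡⟨ cong (_+ sum (λ x → D x x * D x x)) (trans (*-distribˡ-sum 3 (λ x → sum λ y → D x y))
         (sum-cong-≗ λ x → *-distribˡ-sum 3 (D x))) ⟩
  sum (λ x → sum λ y → 3 * D x y) + sum (λ x → D x x * D x x)
    -- The 2 completes the diagonal term that `sum-mono-except` moves across; it costs 2n in total.
    ≤⟨ +-monoʳ-≤ (sum (λ x → sum λ y → 3 * D x y)) (sum-mono λ x → m≤m+n (D x x * D x x) 2) ⟩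
  sum (λ x → sum λ y → 3 * D x y) + sum (λ x → D x x * D x x + 2)
    ≡⟨ ∑-distrib-+ (λ x → sum λ y → 3 * D x y) (λ x → D x x * D x x + 2) ⟨
  sum (λ x → sum (λ y → 3 * D x y) + (D x x * D x x + 2))
    ≤⟨ sum-mono (λ x → sum-mono-except (λ y → 3 * D x y) (λ y → D x y * D x y + 2) x λ y _ → 3d≤d²+2 (D x y)) ⟩
  sum (λ x → sum (λ y → D x y * D x y + 2) + 3 * D x x)
    ≡⟨ ∑-distrib-+ (λ x → sum (λ y → D x y * D x y + 2)) (λ x → 3 * D x x) ⟩
  sum (λ x → sum (λ y → D x y * D x y + 2)) + sum (λ x → 3 * D x x)
    ≡⟨ cong₂ _+_ squares (trans (sym (*-distribˡ-sum 3 (λ x → D x x))) (cong (3 *_) (∑codegree-diagonal A))) ⟩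
  sum (λ i → sum λ j → ∣ A i ∩ A j ∣ * ∣ A i ∩ A j ∣) + n * (n * 2) + 3 * sum (λ i → ∣ A i ∣) ∎
  where
  open ≤-Reasoning
  D = codegree A
  diagonal² : sum (λ x → D x x * D x x) ≡ sum (λ i → sum λ j → ∣ A i ∩ A j ∣)
  diagonal² = trans (sum-cong-≗ λ x → codegree-square A x x)
    (trans (∑-comm λ x i → codegree (λ j → A i ∩ A j) x x)
      (sum-cong-≗ λ i → ∑codegree-diagonal λ j → A i ∩ A j))
  squares : sum (λ x → sum (λ y → D x y * D x y + 2)) ≡
            sum (λ i → sum λ j → ∣ A i ∩ A j ∣ * ∣ A i ∩ A j ∣) + n * (n * 2)
  squares = trans
    (sum-cong-≗ λ x → trans (∑-distrib-+ (λ y → D x y * D x y) (λ _ → 2)) (cong (sum (λ y → D x y * D x y) +_) (sum-const n 2)))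
    (trans (∑-distrib-+ (λ x → sum λ y → D x y * D x y) (λ _ → n * 2)) (cong₂ _+_
      (trans (sum-cong-≗ λ x → sum-cong-≗ λ y → codegree-square A x y)
        (trans (∑-comm₃ λ x y i → codegree (λ j → A i ∩ A j) x y)
          (sum-cong-≗ λ i → ∑∑codegree λ j → A i ∩ A j)))
      (sum-const n (n * 2))))

lookup-injective : ∀ {A : Set} {xs : List A} → Unique xs → ∀ {i j} → List.lookup xs i ≡ List.lookup xs j → i ≡ j
lookup-injective (_ ∷ _)  {zero}  {zero}  _  = refl
lookup-injective (x∉ ∷ _) {zero}  {suc j} eq = contradiction eq (All.lookup x∉ (∈-lookup j))
lookup-injective (x∉ ∷ _) {suc i} {zero}  eq = contradiction (sym eq) (All.lookup x∉ (∈-lookup i))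
lookup-injective (_ ∷ u)  {suc i} {suc j} eq = cong suc (lookup-injective u eq)

x*[x∸1]+x : ∀ x → x * (x ∸ 1) + x ≡ x * x
x*[x∸1]+x zero    = refl
x*[x∸1]+x (suc x) = lemma x
  where
  lemma : ∀ x → suc x * x + suc x ≡ suc x * suc x
  lemma = solve-∀

-- Intersections in a free hypergraph

module UpperBound {r n : ℕ} (4≤r : 4 ≤ r) (H : UniformHypergraph r n) (free : Free (3 * r ∸ 4) 3 H) where

  M = size H

  A : Fin M → Subset n
  A = List.lookup (edges H)

  A-injective : ∀ {i j} → A i ≡ A j → i ≡ j
  A-injective = lookup-injective (unique H)

  ∣A∣ : ∀ i → ∣ A i ∣ ≡ r
  ∣A∣ i = All.lookup (uniform H) (∈-lookup i)

  κ : Fin M → Fin M → ℕ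
  κ i j = ∣ A i ∩ A j ∣

  κ≤r : ∀ i j → κ i j ≤ r
  κ≤r i j = subst (κ i j ≤_) (∣A∣ i) (∣p∩q∣≤∣p∣ (A i) (A j))

  -- Three edges lose at most 3, and `κ i k` is at most the second part of the loss. So an edge with
  -- two or more vertices in common with another one shares at most one with any third.
  κ+κ≤3 : ∀ {i j k} → i ≢ j → i ≢ k → j ≢ k → κ i j + κ i k ≤ 3
  κ+κ≤3 {i} {j} {k} i≢j i≢k j≢k = +-cancelˡ-≤ (3 * r) _ _ (begin
    3 * r + (κ i j + κ i k)   ≤⟨ +-mono-≤ 3r≤ (+-monoʳ-≤ (κ i j) κ≤) ⟩
    (U + 3) + (κ i j + ∣ (A i ∪ A j) ∩ A k ∣) ≡⟨ swap U 3 (κ i j + ∣ (A i ∪ A j) ∩ A k ∣) ⟩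
    (U + (κ i j + ∣ (A i ∪ A j) ∩ A k ∣)) + 3 ≡⟨ cong (_+ 3) (∣∪∪∣ (A i) (A j) (A k)) ⟩
    ∣ A i ∣ + ∣ A j ∣ + ∣ A k ∣ + 3 ≡⟨ cong (_+ 3) (cong₂ _+_ (cong₂ _+_ (∣A∣ i) (∣A∣ j)) (∣A∣ k)) ⟩
    r + r + r + 3             ≡⟨ cong (_+ 3) (r+r+r r) ⟩
    3 * r + 3                 ∎)
    where
    open ≤-Reasoning
    U = ∣ (A i ∪ A j) ∪ A k ∣
    swap : ∀ a b c → (a + b) + c ≡ (a + c) + b
    swap = solve-∀
    r+r+r : ∀ r → r + r + r ≡ 3 * r
    r+r+r = solve-∀
    κ≤ : κ i k ≤ ∣ (A i ∪ A j) ∩ A k ∣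
    κ≤ = p⊆q⇒∣p∣≤∣q∣ λ x∈ → let x∈i , x∈k = x∈p∩q⁻ (A i) (A k) x∈ in
      x∈p∩q⁺ (x∈p∪q⁺ (inj₁ x∈i) , x∈k)
    U≡ : A i ∪ (A j ∪ (A k ∪ _)) ≡ (A i ∪ A j) ∪ A k
    U≡ = trans (cong (λ u → A i ∪ (A j ∪ u)) (∪-identityʳ (A k))) (sym (∪-assoc (A i) (A j) (A k)))
    large : 3 * r ∸ 4 + 1 ≤ U
    large = subst (λ u → 3 * r ∸ 4 + 1 ≤ ∣ u ∣) U≡
      (free (A i ∷ A j ∷ A k ∷ [])
        (((i≢j ∘ A-injective) ∷ (i≢k ∘ A-injective) ∷ []) ∷ ((j≢k ∘ A-injective) ∷ []) ∷ [] ∷ [])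
        (λ { (here refl) → ∈-lookup i ; (there (here refl)) → ∈-lookup j ; (there (there (here refl))) → ∈-lookup k })
        refl)
    3r≤ : 3 * r ≤ U + 3
    3r≤ = begin
      3 * r             ≡⟨ m∸n+n≡m (≤-trans 4≤r (m≤m+n r _)) ⟨
      3 * r ∸ 4 + 4     ≡⟨ +-assoc (3 * r ∸ 4) 1 3 ⟨
      3 * r ∸ 4 + 1 + 3 ≤⟨ +-monoˡ-≤ 3 large ⟩
      U + 3             ∎

  Heavy : Fin M → Set
  Heavy i = ∃[ j ] i ≢ j × 3 ≤ κ i j

  heavy? : ∀ i → Dec (Heavy i)
  heavy? i = Finₚ.any? λ j → ¬? (i Fin.≟ j) ×-dec (3 ≤? κ i j)

  heavy : Fin M → ℕ
  heavy i = [ does (heavy? i) ]ᵇ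

  -- The excess of κ² over κ. It vanishes for κ ≤ 1, so off the diagonal every row has at most one
  -- nonzero term.
  φ : ℕ → ℕ
  φ x = x * (x ∸ 1)

  ≤1⇒φ≡0 : ∀ {x} → x ≤ 1 → φ x ≡ 0
  ≤1⇒φ≡0 z≤n       = refl
  ≤1⇒φ≡0 (s≤s z≤n) = refl

  φ-mono : ∀ {x y} → x ≤ y → φ x ≤ φ y
  φ-mono x≤y = *-mono-≤ x≤y (∸-monoˡ-≤ 1 x≤y)

  -- If `i` is not heavy, κ ≤ 2 and φ 2 = 2; otherwise φ κ ≤ φ r ≤ r².
  φκ≤ : ∀ {i j} → i ≢ j → φ (κ i j) ≤ 2 + heavy i * (r * r)
  φκ≤ {i} {j} i≢j with heavy? i
  ... | yes _ = ≤-trans (φ-mono (κ≤r i j)) (≤-trans (m≤m+n (φ r) r)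
    (≤-trans (≤-reflexive (x*[x∸1]+x r)) (≤-trans (≤-reflexive (sym (+-identityʳ (r * r)))) (m≤n+m _ 2))))
  ... | no ¬heavy = ≤-trans (φ-mono (≤-pred (≰⇒> λ 3≤κ → ¬heavy (j , i≢j , 3≤κ)))) (m≤m+n 2 _)

  sum-≤1 : ∀ {x y} → x + y ≤ 3 → x ≤ 1 ⊎ y ≤ 1
  sum-≤1 {zero}        _ = inj₁ z≤n
  sum-≤1 {suc zero}    _ = inj₁ ≤-refl
  sum-≤1 {suc (suc x)} {y} (s≤s (s≤s x+y≤1)) = inj₂ (≤-trans (m≤n+m y x) x+y≤1)

  ∑φκ : ∀ i → sum (λ j → φ (κ i j)) ≤ φ r + (2 + heavy i * (r * r))
  ∑φκ i = split i (λ j → φ (κ i j)) (≤-reflexive (cong φ (trans (cong ∣_∣ (∩-idem (A i))) (∣A∣ i))))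
    (λ j → φκ≤ ∘ (_∘ sym))
    λ j k j≢i k≢i j≢k → Sum.map (≤1⇒φ≡0 {κ i j}) (≤1⇒φ≡0 {κ i k}) (sum-≤1 (κ+κ≤3 (j≢i ∘ sym) (k≢i ∘ sym) j≢k))
    where
    split : ∀ {m} (i : Fin m) (h : Fin m → ℕ) {a c} → h i ≤ a → (∀ j → j ≢ i → h j ≤ c) →
      (∀ j k → j ≢ i → k ≢ i → j ≢ k → h j ≡ 0 ⊎ h k ≡ 0) → sum h ≤ a + c
    split {suc m} i h {a} {c} hi≤a h≤c sparse = subst (_≤ a + c) (sym (sum-remove {i = i} h))
      (+-mono-≤ hi≤a (sum-≤-single (removeAt h i) c (λ j → h≤c _ (Finₚ.punchInᵢ≢i i j))
        λ j k j≢k → sparse _ _ (Finₚ.punchInᵢ≢i i j) (Finₚ.punchInᵢ≢i i k) (j≢k ∘ Finₚ.punchIn-injective i j k)))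

  -- If a heavy edge `i` has partner p, any other edge that meets `i` has to be p by `κ+κ≤3`. So no
  -- two further edges pass through a vertex of `i`.
  heavy-degree : ∀ x → sum (λ i → heavy i * χ (A i) x) ≤ 2
  heavy-degree x = sum-≤-double (λ i → heavy i * χ (A i) x) 1
    (λ i → *-mono-≤ ([]ᵇ≤1 (does (heavy? i))) ([]ᵇ≤1 (Vec.lookup (A i) x))) three
    where
    []ᵇ≤1 : ∀ b → [ b ]ᵇ ≤ 1
    []ᵇ≤1 true  = ≤-refl
    []ᵇ≤1 false = z≤n
    through : ∀ i → heavy i * χ (A i) x ≡ 0 ⊎ Heavy i × χ (A i) x ≡ 1
    through i with heavy? i | Vec.lookup (A i) x
    ... | no _  | _     = inj₁ refl
    ... | yes _ | false = inj₁ refl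
    ... | yes h | true  = inj₂ (h , refl)
    1≤κ : ∀ {i j} → χ (A i) x ≡ 1 → χ (A j) x ≡ 1 → 1 ≤ κ i j
    1≤κ {i} {j} x∈i x∈j = begin
      1                                ≡⟨ trans (χ-∩ (A i) (A j) x) (cong₂ _*_ x∈i x∈j) ⟨
      χ (A i ∩ A j) x                  ≤⟨ m≤n+m _ _ ⟩
      sum {n} (λ _ → 0) + χ (A i ∩ A j) x ≤⟨ sum-mono-except (λ _ → 0) (χ (A i ∩ A j)) x (λ _ _ → z≤n) ⟩
      sum (χ (A i ∩ A j)) + 0          ≡⟨ trans (+-identityʳ _) (sym (∣∣≡∑χ (A i ∩ A j))) ⟩
      κ i j                            ∎
      where open ≤-Reasoning
    apart : ∀ {i j p} → i ≢ j → i ≢ p → 3 ≤ κ i p → χ (A i) x ≡ 1 → χ (A j) x ≡ 1 → p ≡ j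
    apart {i} {j} {p} i≢j i≢p 3≤κ x∈i x∈j = decidable-stable (p Fin.≟ j) λ p≢j →
      <⇒≱ (+-mono-≤ 3≤κ (1≤κ x∈i x∈j)) (κ+κ≤3 i≢p i≢j p≢j)
    three : ∀ i j k → i ≢ j → i ≢ k → j ≢ k →
      heavy i * χ (A i) x ≡ 0 ⊎ heavy j * χ (A j) x ≡ 0 ⊎ heavy k * χ (A k) x ≡ 0
    three i j k i≢j i≢k j≢k with through i | through j | through k
    ... | inj₁ i₀ | _       | _       = inj₁ i₀
    ... | inj₂ _  | inj₁ j₀ | _       = inj₂ (inj₁ j₀)
    ... | inj₂ _  | inj₂ _  | inj₁ k₀ = inj₂ (inj₂ k₀)
    ... | inj₂ ((p , i≢p , 3≤κ) , x∈i) | inj₂ (_ , x∈j) | inj₂ (_ , x∈k) =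
      contradiction (trans (sym (apart i≢j i≢p 3≤κ x∈i x∈j)) (apart i≢k i≢p 3≤κ x∈i x∈k)) j≢k

  ∑heavy*r≤ : sum heavy * r ≤ n * 2
  ∑heavy*r≤ = begin
    sum heavy * r                                ≡⟨ *-distribʳ-sum r heavy ⟩
    sum (λ i → heavy i * r)                      ≡⟨ sum-cong-≗ (λ i → cong (heavy i *_) (trans (sym (∣A∣ i)) (∣∣≡∑χ (A i)))) ⟩
    sum (λ i → heavy i * sum (χ (A i)))          ≡⟨ sum-cong-≗ (λ i → *-distribˡ-sum (heavy i) (χ (A i))) ⟩
    sum (λ i → sum λ x → heavy i * χ (A i) x)    ≡⟨ ∑-comm (λ i x → heavy i * χ (A i) x) ⟩
    sum (λ x → sum λ i → heavy i * χ (A i) x)    ≤⟨ sum-mono heavy-degree ⟩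
    sum {n} (λ _ → 2)                            ≡⟨ sum-const n 2 ⟩
    n * 2                                        ∎
    where open ≤-Reasoning

  ∑∑κ² : sum (λ i → sum λ j → κ i j * κ i j) ≤
         sum (λ i → sum λ j → κ i j) + (M * (φ r + 2) + sum heavy * (r * r))
  ∑∑κ² = begin
    sum (λ i → sum λ j → κ i j * κ i j)
      ≡⟨ sum-cong-≗ (λ i → trans (sum-cong-≗ λ j → trans (sym (x*[x∸1]+x (κ i j))) (+-comm (φ (κ i j)) (κ i j)))
           (∑-distrib-+ (κ i) (λ j → φ (κ i j)))) ⟩
    sum (λ i → sum (κ i) + sum (λ j → φ (κ i j)))
      ≤⟨ sum-mono (λ i → +-monoʳ-≤ (sum (κ i)) (≤-trans (∑φκ i) (≤-reflexive (sym (+-assoc (φ r) 2 _))))) ⟩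
    sum (λ i → sum (κ i) + (φ r + 2 + heavy i * (r * r)))
      ≡⟨ ∑-distrib-+ (λ i → sum (κ i)) (λ i → φ r + 2 + heavy i * (r * r)) ⟩
    sum (λ i → sum (κ i)) + sum (λ i → φ r + 2 + heavy i * (r * r))
      ≡⟨ cong (sum (λ i → sum (κ i)) +_) (trans (∑-distrib-+ (λ _ → φ r + 2) (λ i → heavy i * (r * r)))
           (cong₂ _+_ (sum-const M (φ r + 2)) (sym (*-distribʳ-sum (r * r) heavy)))) ⟩
    sum (λ i → sum (κ i)) + (M * (φ r + 2) + sum heavy * (r * r)) ∎
    where open ≤-Reasoning

  -- Here m = r² - r - 1. `pair-count` reads 3Mr² + S ≤ S₂ + 2n² + 3Mr, and `∑∑κ²` with `∑heavy*r≤`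
  -- gives S₂ ≤ S + M(m + 3) + 2rn. So S cancels and 2Mm ≤ 2n² + 2rn remains.
  size-bound : ∀ {m} → suc (m + r) ≡ r * r → M * m ≤ n * n + r * n
  size-bound {m} m≡ = *-cancelˡ-≤ 2 (+-cancelʳ-≤ (M * m + 3 * (M * r) + 3 * M + S) _ _ (begin
    2 * (M * m) + (M * m + 3 * (M * r) + 3 * M + S)           ≡⟨ e₁ M m r S ⟩
    3 * (M * suc (m + r)) + S                                 ≡⟨ cong (λ z → 3 * (M * z) + S) m≡ ⟩
    3 * (M * (r * r)) + S                                     ≡⟨ cong (λ z → 3 * z + S) (sum-sizes (λ a → a * a)) ⟨
    3 * sum (λ i → ∣ A i ∣ * ∣ A i ∣) + S                     ≤⟨ pair-count A ⟩
    S₂ + n * (n * 2) + 3 * sum (λ i → ∣ A i ∣)                ≡⟨ cong (λ z → S₂ + n * (n * 2) + 3 * z) (sum-sizes (λ a → a)) ⟩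
    S₂ + n * (n * 2) + 3 * (M * r)                            ≤⟨ +-monoˡ-≤ (3 * (M * r)) (+-monoˡ-≤ (n * (n * 2)) ∑∑κ²) ⟩
    S + (M * (φ r + 2) + sum heavy * (r * r)) + n * (n * 2) + 3 * (M * r)
      ≡⟨ cong₂ (λ z w → S + (M * (z + 2) + w) + n * (n * 2) + 3 * (M * r)) φr (sym (*-assoc (sum heavy) r r)) ⟩
    S + (M * (suc m + 2) + sum heavy * r * r) + n * (n * 2) + 3 * (M * r)
      ≤⟨ +-monoˡ-≤ (3 * (M * r)) (+-monoˡ-≤ (n * (n * 2)) (+-monoʳ-≤ S (+-monoʳ-≤ (M * (suc m + 2)) (*-monoˡ-≤ r ∑heavy*r≤)))) ⟩
    S + (M * (suc m + 2) + n * 2 * r) + n * (n * 2) + 3 * (M * r)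
      ≡⟨ e₂ M m r n S ⟩
    2 * (n * n + r * n) + (M * m + 3 * (M * r) + 3 * M + S)   ∎))
    where
    open ≤-Reasoning
    S S₂ : ℕ
    S = sum (λ i → sum λ j → κ i j)
    S₂ = sum (λ i → sum λ j → κ i j * κ i j)
    sum-sizes : ∀ (h : ℕ → ℕ) → sum (λ i → h ∣ A i ∣) ≡ M * h r
    sum-sizes h = trans (sum-cong-≗ λ i → cong h (∣A∣ i)) (sum-const M (h r))
    φr : φ r ≡ suc m
    φr = +-cancelʳ-≡ r (φ r) (suc m) (trans (x*[x∸1]+x r) (sym m≡))
    e₁ : ∀ M m r S → 2 * (M * m) + (M * m + 3 * (M * r) + 3 * M + S) ≡ 3 * (M * suc (m + r)) + S
    e₁ = solve-∀
    e₂ : ∀ M m r n S → S + (M * (suc m + 2) + n * 2 * r) + n * (n * 2) + 3 * (M * r) ≡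
      2 * (n * n + r * n) + (M * m + 3 * (M * r) + 3 * M + S)
    e₂ = solve-∀

-- The limit

[a+c]^1+p≤ : ∀ a c p → (a + c) ^ suc p ≤ a ^ suc p + suc p * c * (a + c) ^ p
[a+c]^1+p≤ a c zero    = ≤-reflexive (lemma a c)
  where
  lemma : ∀ a c → (a + c) * 1 ≡ a * 1 + (c + 0) * 1
  lemma = solve-∀
[a+c]^1+p≤ a c (suc p) = begin
  u * u ^ suc p                                         ≤⟨ *-monoʳ-≤ u ([a+c]^1+p≤ a c p) ⟩
  u * (a ^ suc p + suc p * c * u ^ p)                   ≡⟨ expand a c p (a ^ suc p) (u ^ p) ⟩
  a * a ^ suc p + c * a ^ suc p + suc p * c * (u * u ^ p) ≤⟨ +-monoˡ-≤ _ (+-monoʳ-≤ (a * a ^ suc p) (*-monoʳ-≤ c (^-monoˡ-≤ (suc p) (m≤m+n a c)))) ⟩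
  a * a ^ suc p + c * u ^ suc p + suc p * c * u ^ suc p ≡⟨ collect (a * a ^ suc p) c (suc p) (u ^ suc p) ⟩
  a * a ^ suc p + suc (suc p) * c * u ^ suc p           ∎
  where
  open ≤-Reasoning
  u = a + c
  expand : ∀ a c p x y → (a + c) * (x + suc p * c * y) ≡ a * x + c * x + suc p * c * ((a + c) * y)
  expand = solve-∀
  collect : ∀ x c p y → x + c * y + p * c * y ≡ x + suc p * c * y
  collect = solve-∀

-- Scanning down from `b`, the first index with `g k ≤ n` works, since its successor has just been
-- rejected.
crossing : ∀ (g : ℕ → ℕ) {n} b → g 0 ≤ n → n < g b → ∃[ k ] g k ≤ n × n < g (suc k)
crossing g zero    g₀≤n n<g₀ = contradiction n<g₀ (≤⇒≯ g₀≤n)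
crossing g {n} (suc b) g₀≤n n<g with g b ≤? n
... | yes gb≤n = b , gb≤n , n<g
... | no  gb≰n = crossing g b g₀≤n (≰⇒> gb≰n)

-- X bounds v from above and Y bounds G from below. X - Y is at most s u^(p+1), from replacing s by
-- s - 1, plus s² (p+1) c u^p, from replacing u by a. The two size conditions make each at most X /
-- (2(q + 1)).
dense-step : ∀ q s₋ s a c u p {v G} → s ≡ suc s₋ → u ≡ a + c → 2 * suc q ≤ s →
  2 * suc q * (suc p * c) ≤ u → v ≤ s * s * u ^ suc p → s₋ * s * a ^ suc p ≤ G → q * v ≤ suc q * G
dense-step q s₋ s a c u p {v} {G} s≡ u≡a+c 2[1+q]≤s wide v≤X Y≤G = *-cancelˡ-≤ 2 (+-cancelʳ-≤ (2 * X) _ _ (begin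
  2 * (q * v) + 2 * X                 ≤⟨ +-monoˡ-≤ (2 * X) (*-monoʳ-≤ 2 (*-monoʳ-≤ q v≤X)) ⟩
  2 * (q * X) + 2 * X                 ≡⟨ e₁ q X ⟩
  2 * suc q * X                       ≤⟨ *-monoʳ-≤ (2 * suc q) X≤ ⟩
  2 * suc q * (Y + s * u ^ suc p + s * s * (suc p * c * u ^ p)) ≡⟨ e₂ (2 * suc q) Y s (u ^ suc p) (suc p * c) (u ^ p) ⟩
  2 * suc q * Y + 2 * suc q * (s * u ^ suc p) + s * s * (2 * suc q * (suc p * c) * u ^ p)
    ≤⟨ +-mono-≤ (+-monoʳ-≤ (2 * suc q * Y) (*-monoˡ-≤ (s * u ^ suc p) 2[1+q]≤s))
         (*-monoʳ-≤ (s * s) (*-monoˡ-≤ (u ^ p) wide)) ⟩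
  2 * suc q * Y + s * (s * u ^ suc p) + s * s * (u * u ^ p) ≡⟨ e₃ (suc q) Y s (u * u ^ p) ⟩
  2 * (suc q * Y) + 2 * X             ≤⟨ +-monoˡ-≤ (2 * X) (*-monoʳ-≤ 2 (*-monoʳ-≤ (suc q) Y≤G)) ⟩
  2 * (suc q * G) + 2 * X             ∎))
  where
  open ≤-Reasoning
  X Y : ℕ
  X = s * s * u ^ suc p
  Y = s₋ * s * a ^ suc p
  e₁ : ∀ q X → 2 * (q * X) + 2 * X ≡ 2 * suc q * X
  e₁ = solve-∀
  e₂ : ∀ q Y s v w z → q * (Y + s * v + s * s * (w * z)) ≡ q * Y + q * (s * v) + s * s * (q * w * z)
  e₂ = solve-∀
  e₃ : ∀ q Y s v → 2 * q * Y + s * (s * v) + s * s * v ≡ 2 * (q * Y) + 2 * (s * s * v)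
  e₃ = solve-∀
  split : ∀ t s v w → (s + t * s) * (v + w) ≡ t * s * v + s * v + (s + t * s) * w
  split = solve-∀
  s*s≡ : s * s ≡ s + s₋ * s
  s*s≡ = cong (_* s) s≡
  X≤ : X ≤ Y + s * u ^ suc p + s * s * (suc p * c * u ^ p)
  X≤ = begin
    s * s * u ^ suc p                                   ≡⟨ cong₂ (λ z w → z * w ^ suc p) s*s≡ u≡a+c ⟩
    (s + s₋ * s) * (a + c) ^ suc p                      ≤⟨ *-monoʳ-≤ (s + s₋ * s) ([a+c]^1+p≤ a c p) ⟩
    (s + s₋ * s) * (a ^ suc p + suc p * c * (a + c) ^ p) ≡⟨ split s₋ s (a ^ suc p) (suc p * c * (a + c) ^ p) ⟩
    Y + s * a ^ suc p + (s + s₋ * s) * (suc p * c * (a + c) ^ p)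
      ≡⟨ cong₂ (λ z w → Y + s * a ^ suc p + z * (suc p * c * w ^ p)) s*s≡ u≡a+c ⟨
    Y + s * a ^ suc p + s * s * (suc p * c * u ^ p)
      ≤⟨ +-monoˡ-≤ (s * s * (suc p * c * u ^ p)) (+-monoʳ-≤ Y (*-monoʳ-≤ s
           (^-monoˡ-≤ (suc p) (subst (a ≤_) (sym u≡a+c) (m≤m+n a c))))) ⟩
    Y + s * u ^ suc p + s * s * (suc p * c * u ^ p)     ∎

-- If g is at least (1 − 1/s) a²ᴷ⁺² s² at n ≥ s Nᴷ⁺¹ for every N = a + 1 in an arithmetic
-- progression, then g n ≥ (1 − 1/(q + 1)) n² for large n: the progression has a term with
-- s Nᴷ⁺¹ ≤ n < s uᴷ⁺¹, where u is the next term.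
module Asymptotics (s₋ ℓ x K q : ℕ) .{{_ : NonZero ℓ}} .{{_ : NonZero x}} (g : ℕ → ℕ)
  (2[1+q]≤s : 2 * suc q ≤ suc s₋)
  (dense : ∀ k {n} → suc s₋ * suc (ℓ * (k * x)) ^ suc K ≤ n →
    s₋ * suc s₋ * (ℓ * (k * x)) ^ suc (K + suc K) ≤ g n)
  where

  s p : ℕ
  s = suc s₋
  p = K + suc K

  N : ℕ → ℕ
  N k = suc (ℓ * (k * x))

  -- The distance from `N k ∸ 1`, the base of the guaranteed power, to `N (suc k)`; hence the `suc`.
  c : ℕ
  c = suc (ℓ * x)

  -- The first summand makes the term `N 0 ≡ 1` fit, so that the search can start; the second makes
  -- the next term large enough for `dense-step`.
  threshold : ℕ
  threshold = s + s * (2 * suc q * (suc p * c)) ^ suc K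

  n<s*N^ : ∀ n → n < s * N n ^ suc K
  n<s*N^ n = begin-strict
    n                ≤⟨ m≤m*n n (x * ℓ) ⟩
    n * (x * ℓ)      ≡⟨ trans (sym (*-assoc n x ℓ)) (*-comm (n * x) ℓ) ⟩
    ℓ * (n * x)      <⟨ n<1+n _ ⟩
    N n              ≤⟨ m≤m*n (N n) (N n ^ K) ⟩
    N n ^ suc K      ≤⟨ m≤n*m (N n ^ suc K) s ⟩
    s * N n ^ suc K  ∎
    where
    open ≤-Reasoning
    instance
      _ = m^n≢0 (N n) K
      _ = m*n≢0 x ℓ

  s*N₀^≡s : s * N 0 ^ suc K ≡ s
  s*N₀^≡s = trans (cong (λ z → s * suc z ^ suc K) (*-zeroʳ ℓ))
    (trans (cong (s *_) (^-zeroˡ (suc K))) (*-identityʳ s))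

  lower-bound-between : ∀ {n} k → threshold ≤ n → s * N k ^ suc K ≤ n → n < s * N (suc k) ^ suc K →
    q * (n * n) ≤ suc q * g n
  lower-bound-between {n} k large fits beyond =
    dense-step q s₋ s (ℓ * (k * x)) c (N (suc k)) p refl (next ℓ k x) 2[1+q]≤s
      (wide (N (suc k)) beyond) (square (N (suc k)) beyond) (dense k fits)
    where
    open ≤-Reasoning
    next : ∀ l k x → suc (l * (suc k * x)) ≡ l * (k * x) + suc (l * x)
    next = solve-∀
    interchange : ∀ s v → s * v * (s * v) ≡ s * s * (v * v)
    interchange = solve-∀
    square : ∀ u → n < s * u ^ suc K → n * n ≤ s * s * u ^ suc p
    square u n<u = begin
      n * n                           ≤⟨ *-mono-≤ (<⇒≤ n<u) (<⇒≤ n<u) ⟩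
      s * u ^ suc K * (s * u ^ suc K) ≡⟨ interchange s (u ^ suc K) ⟩
      s * s * (u ^ suc K * u ^ suc K) ≡⟨ cong (s * s *_) (^-distribˡ-+-* u (suc K) (suc K)) ⟨
      s * s * u ^ suc p               ∎
    wide : ∀ u → n < s * u ^ suc K → 2 * suc q * (suc p * c) ≤ u
    wide u n<u = ≮⇒≥ λ u<w → <⇒≱ n<u (begin
      s * u ^ suc K                               ≤⟨ *-monoʳ-≤ s (^-monoˡ-≤ (suc K) (<⇒≤ u<w)) ⟩
      s * (2 * suc q * (suc p * c)) ^ suc K       ≤⟨ m≤n+m _ s ⟩
      threshold                                   ≤⟨ large ⟩
      n                                           ∎)

  lower-bound : ∀ {n} → threshold ≤ n → q * (n * n) ≤ suc q * g n
  lower-bound {n} large =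
    let k , fits , beyond = crossing (λ k → s * N k ^ suc K) n
          (subst (_≤ n) (sym s*N₀^≡s) (≤-trans (m≤m+n s _) large)) (n<s*N^ n)
    in lower-bound-between k large fits beyond

-- Choice of the parameters

packing-size : ∀ d s₋ t {n} → let s = suc s₋; r = 3 + d; N = suc (Twin.orientedEdges (suc d) * t) in
  CoprimeBelow (2 + 2 * suc d) s → CoprimeBelow s N → s * N ^ suc (s * s) ≤ n →
  s₋ * (s * t) * (N ^ (s * s) * N ^ suc (s * s)) * 2 ≤ f r n (3 * r ∸ 4) 3
packing-size d s₋ t {n} cop-s cop-N fits = subst (_≤ f r n (3 * r ∸ 4) 3) size-hypergraph
  (IsMaxSize.upperBound (f-isMaxSize r n (3 * r ∸ 4) 3) hypergraph hypergraph-free)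
  where
  r = 3 + d
  open Packing d s₋ t (suc s₋) (suc (Twin.orientedEdges (suc d) * t)) n (n<1+n s₋) (n<1+n _) cop-s cop-N fits

-- As 2mt = ℓt = N - 1, the number of edges times m is s₋ s (N - 1) N^(2K+1); lowering N to N - 1
-- makes this a pure power.
packing-density : ∀ s₋ s ℓ t K {m} → 2 * m ≡ ℓ → let N = suc (ℓ * t) in
  s₋ * s * (ℓ * t) ^ suc (K + suc K) ≤ s₋ * (s * t) * (N ^ K * N ^ suc K) * 2 * m
packing-density s₋ s ℓ t K {m} 2m≡ℓ = begin
  s₋ * s * (a * a ^ p)                       ≤⟨ *-monoʳ-≤ (s₋ * s) (*-monoʳ-≤ a (^-monoˡ-≤ p (n≤1+n a))) ⟩
  s₋ * s * (a * N ^ p)                       ≡⟨ cong₂ (λ x y → s₋ * s * (x * t * y)) (sym 2m≡ℓ) (^-distribˡ-+-* N K (suc K)) ⟩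
  s₋ * s * (2 * m * t * (N ^ K * N ^ suc K)) ≡⟨ regroup s₋ s m t (N ^ K * N ^ suc K) ⟩
  s₋ * (s * t) * (N ^ K * N ^ suc K) * 2 * m ∎
  where
  open ≤-Reasoning
  a = ℓ * t
  p = K + suc K
  N = suc a
  regroup : ∀ x s m t y → x * s * (2 * m * t * y) ≡ x * (s * t) * y * 2 * m
  regroup = solve-∀

lower-bound : ∀ d {m} q → 2 * m ≡ Twin.orientedEdges (suc d) → let r = 3 + d in
  ∃[ n₀ ] ∀ {n} → n₀ ≤ n → q * (n * n) ≤ suc q * (f r n (3 * r ∸ 4) 3 * m)
-- `s = 1 + 2 * suc q * R !` is coprime to all positive numbers below `R` and large enough for
-- `dense-step`.
lower-bound d {m} q 2m≡ℓ = instantiate (2 * suc q * R !)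
    (≤-trans (subst (_≤ 2 * suc q * R !) (*-identityʳ (2 * suc q)) (*-monoʳ-≤ (2 * suc q) (1≤n! R))) (n≤1+n _))
    (suc-*!-coprimeBelow R (2 * suc q))
  where
  r = 3 + d
  R = 2 + 2 * suc d
  ℓ = Twin.orientedEdges (suc d)
  instantiate : ∀ s₋ → 2 * suc q ≤ suc s₋ → CoprimeBelow R (suc s₋) →
    ∃[ n₀ ] ∀ {n} → n₀ ≤ n → q * (n * n) ≤ suc q * (f r n (3 * r ∸ 4) 3 * m)
  instantiate s₋ 2[1+q]≤s cop-s = threshold , λ {n} → Asymptotics.lower-bound s₋ ℓ (s !) (s * s) q g 2[1+q]≤s dense {n}
    where
    s = suc s₋
    instance _ = s !≢0
    g : ℕ → ℕ
    g n = f r n (3 * r ∸ 4) 3 * m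
    dense : ∀ k {n} → s * suc (ℓ * (k * s !)) ^ suc (s * s) ≤ n →
      s₋ * s * (ℓ * (k * s !)) ^ suc (s * s + suc (s * s)) ≤ g n
    -- The multiplicity t = `k * s !` makes N = 1 + ℓt coprime to all positive numbers below `s`.
    dense k fits = ≤-trans (packing-density s₋ s ℓ (k * s !) (s * s) 2m≡ℓ)
      (*-monoˡ-≤ m (packing-size d s₋ (k * s !) cop-s
        (subst (CoprimeBelow s ∘ suc) (*-assoc ℓ k (s !)) (suc-*!-coprimeBelow s (ℓ * k))) fits))
    threshold = Asymptotics.threshold s₋ ℓ (s !) (s * s) q g 2[1+q]≤s dense

∣pos-pos∣*q≤ : ∀ {q x y z} → q * x ≤ q * y + z → q * y ≤ q * x + z → q * ℤ.∣ x ℤ.⊖ y ∣ ≤ z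
∣pos-pos∣*q≤ {q} {x} {y} {z} x≤ y≤ with ≤-total x y
... | inj₁ x≤y = subst (_≤ z) (trans (sym (*-distribˡ-∸ q y x)) (cong (q *_) (sym (ℤₚ.∣⊖∣-≤ x≤y))))
  (m≤n+o⇒m∸n≤o (q * y) (q * x) y≤)
... | inj₂ y≤x = subst (_≤ z) (trans (sym (*-distribˡ-∸ q x y))
    (cong (q *_) (trans (sym (ℤₚ.∣⊖∣-≤ y≤x)) (ℤₚ.∣m⊖n∣≡∣n⊖m∣ y x))))
  (m≤n+o⇒m∸n≤o (q * x) (q * y) x≤)

-- Cross-multiplied, the hypothesis says that the distance is below 1/e for the denominator e of ε;
-- the numerator of a positive ε is at least 1.
∣a/b-1/c∣<ε : ∀ a b c .{{_ : NonZero b}} .{{_ : NonZero c}} ε → 0ℚ ℚ.< ε →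
  ℚ.↧ₙ ε * ℤ.∣ a * c ℤ.⊖ b ∣ < b * c → ℚ.∣ pos a ℚ./ b ℚ.- pos 1 ℚ./ c ∣ ℚ.< ε
∣a/b-1/c∣<ε a (suc b) (suc c) ε@(mkℚ (ℤ.+[1+ k ]) e-1 _) _ close = ℚₚ.toℚᵘ-cancel-<
  (ℚᵘₚ.<-respˡ-≃ (ℚᵘₚ.≃-sym difference) (ℚᵘ.*<* numerators))
  where
  e = suc e-1
  difference : ℚ.toℚᵘ ℚ.∣ pos a ℚ./ suc b ℚ.- pos 1 ℚ./ suc c ∣ ℚᵘ.≃ ℚᵘ.∣ mkℚᵘ (pos a) b ℚᵘ.- mkℚᵘ (pos 1) c ∣
  difference = ℚᵘₚ.≃-trans (ℚₚ.toℚᵘ-homo-∣-∣ (pos a ℚ./ suc b ℚ.- pos 1 ℚ./ suc c))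
    (ℚᵘₚ.∣-∣-cong (ℚᵘₚ.≃-trans (ℚₚ.toℚᵘ-homo-+ (pos a ℚ./ suc b) (ℚ.- (pos 1 ℚ./ suc c)))
      (ℚᵘₚ.+-cong (ℚₚ.toℚᵘ-fromℚᵘ (mkℚᵘ (pos a) b))
        (ℚᵘₚ.≃-trans (ℚₚ.toℚᵘ-homo‿- (pos 1 ℚ./ suc c)) (ℚᵘₚ.-‿cong (ℚₚ.toℚᵘ-fromℚᵘ (mkℚᵘ (pos 1) c)))))))
  numerator : pos a ℤ.* pos (suc c) ℤ.+ ℤ.- (pos 1) ℤ.* pos (suc b) ≡ a * suc c ℤ.⊖ suc b
  numerator = trans (cong₂ ℤ._+_ (sym (ℤₚ.pos-* a (suc c))) (ℤₚ.-1*i≡-i (pos (suc b)))) (ℤₚ.m-n≡m⊖n (a * suc c) (suc b))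
  numerators : pos ℤ.∣ pos a ℤ.* pos (suc c) ℤ.+ ℤ.- (pos 1) ℤ.* pos (suc b) ∣ ℤ.* pos e ℤ.<
               pos (suc k) ℤ.* pos (suc b * suc c)
  numerators = subst₂ ℤ._<_
    (trans (ℤₚ.pos-* ℤ.∣ a * suc c ℤ.⊖ suc b ∣ e) (cong (λ z → pos ℤ.∣ z ∣ ℤ.* pos e) (sym numerator)))
    (ℤₚ.pos-* (suc k) (suc b * suc c))
    (ℤ.+<+ (<-≤-trans (subst (_< suc b * suc c) (*-comm e _) close) (m≤m+n _ _)))
∣a/b-1/c∣<ε a (suc b) (suc c) (mkℚ (ℤ.+ 0)     _ _) (ℚ.*<* (ℤ.+<+ ())) _
∣a/b-1/c∣<ε a (suc b) (suc c) (mkℚ ℤ.-[1+ _ ] _ _) (ℚ.*<* ()) _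

-- With q the denominator of ε, both one-sided errors of q · F n · m against q n² are at most n²,
-- and n² < n² m because m ≥ 2. The lower bound is taken at q - 1.
density-converges : ∀ r m .{{_ : NonZero m}} → 4 ≤ r → 2 ≤ m → suc (m + r) ≡ r * r →
  (∀ q → ∃[ n₀ ] ∀ {n} → n₀ ≤ n → q * (n * n) ≤ suc q * (f r n (3 * r ∸ 4) 3 * m)) →
  ConvergesTo (density r (3 * r ∸ 4) 3) (pos 1 ℚ./ m)
density-converges r m 4≤r 2≤m suc[m+r]≡r*r bounded-below ε 0<ε =
  -- From `q * r` on, the linear error q r n of the upper bound is at most n².
  n₀ + q * r , λ n n≥ → ∣a/b-1/c∣<ε (F n) (n ^ 2) m {{m^n≢0 n 2}} ε 0<ε (begin-strict
    q * ℤ.∣ F n * m ℤ.⊖ n ^ 2 ∣    ≤⟨ ∣pos-pos∣*q≤ {q} {F n * m} (upper n n≥) (lower n n≥) ⟩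
    n ^ 2                          <⟨ m<m*n (n ^ 2) m {{m^n≢0 n 2}} 2≤m ⟩
    n ^ 2 * m                      ∎)
  where
  open ≤-Reasoning
  q₋ = ℚ.ℚ.denominator-1 ε
  q : ℕ
  q = suc q₋
  F : ℕ → ℕ
  F n = f r n (3 * r ∸ 4) 3
  n₀ = proj₁ (bounded-below q₋)
  n²≡ : ∀ n → n * n ≡ n ^ 2
  n²≡ n = cong (n *_) (sym (*-identityʳ n))
  F-upper : ∀ {n} → ∃[ H ] (Free {r} {n} (3 * r ∸ 4) 3 H × size H ≡ F n) → F n * m ≤ n * n + r * n
  F-upper {n} (H , free , size≡) = subst (λ z → z * m ≤ n * n + r * n) size≡
    (UpperBound.size-bound 4≤r H free suc[m+r]≡r*r)
  upper : ∀ n → n₀ + q * r ≤ n → q * (F n * m) ≤ q * n ^ 2 + n ^ 2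
  upper n n≥ = begin
    q * (F n * m)             ≤⟨ *-monoʳ-≤ q (F-upper (IsMaxSize.attained (f-isMaxSize r n (3 * r ∸ 4) 3))) ⟩
    q * (n * n + r * n)       ≡⟨ trans (*-distribˡ-+ q (n * n) (r * n)) (cong (q * (n * n) +_) (sym (*-assoc q r n))) ⟩
    q * (n * n) + q * r * n   ≤⟨ +-monoʳ-≤ (q * (n * n)) (*-monoˡ-≤ n (≤-trans (m≤n+m (q * r) n₀) n≥)) ⟩
    q * (n * n) + n * n       ≡⟨ cong (λ z → q * z + z) (n²≡ n) ⟩
    q * n ^ 2 + n ^ 2         ∎
  lower : ∀ n → n₀ + q * r ≤ n → q * n ^ 2 ≤ q * (F n * m) + n ^ 2
  lower n n≥ = begin
    q * n ^ 2                 ≡⟨ +-comm (n ^ 2) (q₋ * n ^ 2) ⟩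
    q₋ * n ^ 2 + n ^ 2        ≡⟨ cong (λ z → q₋ * z + n ^ 2) (n²≡ n) ⟨
    q₋ * (n * n) + n ^ 2      ≤⟨ +-monoˡ-≤ (n ^ 2) (proj₂ (bounded-below q₋) (≤-trans (m≤m+n n₀ _) n≥)) ⟩
    q * (F n * m) + n ^ 2     ∎

r²-r-1≡ : ∀ d → (4 + d) ^ 2 ∸ (4 + d) ∸ 1 ≡ 11 + 7 * d + d * d
r²-r-1≡ d = trans (∸-+-assoc ((4 + d) ^ 2) (4 + d) 1)
  (trans (cong (_∸ (4 + d + 1)) (expand d)) (m+n∸n≡m (11 + 7 * d + d * d) (4 + d + 1)))
  where
  expand : ∀ d → (4 + d) * ((4 + d) * 1) ≡ 11 + 7 * d + d * d + (4 + d + 1)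
  expand = solve-∀

open import Data.Integer using (+_)
open import Data.Rational using (_/_)

theorem3 : (r : ℕ) (4≤r : 4 ≤ r) →
    ConvergesTo (density r (3 * r ∸ 4) 3) ((+ 1 / (r ^ 2 ∸ r ∸ 1)) {{r²-r-1≢0 4≤r}})
theorem3 (suc (suc (suc zero))) (s≤s (s≤s (s≤s ())))
theorem3 r@(suc (suc (suc (suc d)))) 4≤r = density-converges r (r ^ 2 ∸ r ∸ 1) {{r²-r-1≢0 4≤r}} 4≤r
  (subst (2 ≤_) (sym (r²-r-1≡ d)) (s≤s (s≤s z≤n)))
  (trans (cong (λ m → suc (m + r)) (r²-r-1≡ d)) (square d))
  -- `lower-bound` writes the uniformity as 3 + d, hence the `suc`.
  (λ q → lower-bound (suc d) q (trans (cong (2 *_) (r²-r-1≡ d)) (edges-doubled d)))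
  where
  square : ∀ d → suc (11 + 7 * d + d * d + (4 + d)) ≡ (4 + d) * (4 + d)
  square = solve-∀
  edges-doubled : ∀ d → 2 * (11 + 7 * d + d * d) ≡ 2 * (1 + 2 * (2 + d)) + 2 * (2 + d) * (1 + (2 + d))
  edges-doubled = solve-∀
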